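{- $(\text{GLAMoUr},\multimap_{\mathtt{uf}},\equiv,\underline{\,\cdot\,})$ is a reflective explicit distillery. In particular, for every reachable state $s$ of the GLAMoUr machine: (1) (Commutative) if $s\leadsto_{c_i}s'$ with $i\in\{1,2,3,4,5\}$ then $\underline{s}=\underline{s'}$; (2) (Multiplicative) if $s\leadsto_{\mathtt{um}}s'$ then $\underline{s}\multimap_{\mathtt{um}}\equiv\underline{s'}$; (3) (Exponential) if $s\leadsto_{\mathtt{ue}}s'$ then $\underline{s}\multimap_{\mathtt{ue}}\underline{s'}$.
   Context: **Terms.** Terms with explicit substitutions (ES): $t,u,w::=x\mid a\mid\lambda x.t\mid tu\mid t[x\leftarrow u]$, where $x$ ranges over variables, $a$ over a separate set of symbols (constants, never bound), and $t[x\leftarrow u]$ binds $x$ in $t$; terms are up to $\alpha$. $\lambda$-terms are terms without ES; closed means without free variables. On $\lambda$-terms: values $v::=\lambda x.t$, fireballs $f::=v\mid A$, inerts $A::=a\mid Af$. (In terms with ES, values are also the abstractions.) Unfolding: $x{\downarrow}=x$, $a{\downarrow}=a$, $(tu){\downarrow}=t{\downarrow}u{\downarrow}$, $(\lambda x.t){\downarrow}=\lambda x.t{\downarrow}$, $t[x\leftarrow u]{\downarrow}=t{\downarrow}\{x\leftarrow u{\downarrow}\}$, where $\{x\leftarrow u\}$ is capture-avoiding substitution. Contexts (plugging may capture): substitution $L::=\langle\cdot\rangle\mid L[x\leftarrow t]$; shallow $S::=\langle\cdot\rangle\mid St\mid tS\mid S[x\leftarrow t]$; weak $W::=\langle\cdot\rangle\mid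 tW\mid Wt\mid W[x\leftarrow t]\mid t[x\leftarrow W]$. Substitution $S\{x\leftarrow u\}$ on a context leaves the hole unchanged and acts on all its subterms. Relative unfolding: $t{\downarrow}_{\langle\cdot\rangle}=t{\downarrow}$, $t{\downarrow}_{uS}=t{\downarrow}_{Su}=t{\downarrow}_S$, $t{\downarrow}_{S[x\leftarrow u]}=t{\downarrow}_S\{x\leftarrow u{\downarrow}\}$. **Structural equivalence** $\equiv$ (on terms): least equivalence closed under weak contexts containing $t[x\leftarrow u][y\leftarrow w]\equiv t[y\leftarrow w][x\leftarrow u]$ if $y\notin fv(u)$, $x\notin fv(w)$; $(tw)[x\leftarrow u]\equiv t\,(w[x\leftarrow u])$ if $x\notin fv(t)$; $(tw)[x\leftarrow u]\equiv (t[x\leftarrow u])\,w$ if $x\notin fv(w)$; $t[x\leftarrow u][y\leftarrow w]\equiv t[x\leftarrow u[y\leftarrow w]]$ if $y\notin fv(t)$. **Useful Fireball Calculus.** Evaluable shallow contexts: $\langle\cdot\rangle$; $St$ if $S$ is evaluable and $t{\downarrow}$ is a fireball; $tS$ if $S$ is evaluable; $S[x\leftarrow t]$ if $t{\downarrow}$ is a fireball and $S\{x\leftarrow t{\downarrow}\}$ is evaluable. $S$ is applicative if $S=S'\langle L\,u\rangle$ (hole of $S$ = hole of $L$); useful = evaluable and applicative. The strategy on terms is $\multimap_{\mathtt{uf}}=\multimap_{\mathtt{um}}\cup\multimap_{\mathtt{ue}}$ (up to $\alpha$; the displayed $x$ is bound by the displayed ES; moving $L$ outwards captures nothing): $S\langle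 L\langle\lambda x.t\rangle u\rangle\multimap_{\mathtt{um}}S\langle L\langle t[x\leftarrow u]\rangle\rangle$ if $S\langle L\,u\rangle$ is useful; $S\langle S'\langle x\rangle[x\leftarrow L\langle u\rangle]\rangle\multimap_{\mathtt{ue}}S\langle L\langle S'\langle u\rangle[x\leftarrow u]\rangle\rangle$ if $S\langle S'[x\leftarrow L\langle u\rangle]\rangle$ is useful, $u$ is not of the form $u'[y\leftarrow w]$, and $u{\downarrow}_{S\langle L\rangle}$ is a value. **GLAMoUr machine.** Codes $\bar t,\bar u$ are $\lambda$-terms not taken up to $\alpha$. Labels $l::=\mathsf v\mid\mathsf A$. Stack items $\phi::=\bar t\mid(\bar t,\pi)$; stacks $\pi::=\epsilon\mid\phi^l:\pi$; dumps $D::=\epsilon\mid D:(\bar t,\pi)$; environments $E::=\epsilon\mid[x\leftarrow\phi^l]:E$ (written by juxtaposition, $E_1[x\leftarrow\phi^l]E_2$). States are $(D,\bar t,\pi,E)$. Initial states are $(\epsilon,\bar t,\epsilon,\epsilon)$ with $\bar t$ a well-named (all bound names distinct) code of a closed $\lambda$-term; reachable states are those obtained from initial ones by transitions. Transitions: - $(D,\bar t\bar u,\pi,E)\leadsto_{c_1}(D:(\bar t,\pi),\bar u,\epsilon,E)$ - $(D,\lambda x.\bar t,\phi^l:\pi,E)\leadsto_{\mathtt{um}}(D,\bar t,\pi,[x\leftarrow\phi^l]E)$ - $(D:(\bar t,\pi),\lambda x.\bar u,\epsilon,E)\leadsto_{c_2}(D,\bar t,(\lambda x.\bar u)^{\mathsf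 v}:\pi,E)$ - $(D:(\bar t,\pi),a,\pi',E)\leadsto_{c_3}(D,\bar t,(a,\pi')^{\mathsf A}:\pi,E)$ - $(D:(\bar t,\pi),x,\pi',E)\leadsto_{c_4}(D,\bar t,(x,\pi')^{\mathsf A}:\pi,E)$ if $E=E_1[x\leftarrow\phi^{\mathsf A}]E_2$ - $(D:(\bar t,\pi),x,\epsilon,E)\leadsto_{c_5}(D,\bar t,x^{\mathsf v}:\pi,E)$ if $E=E_1[x\leftarrow\bar u^{\mathsf v}]E_2$ - $(D,x,\phi^l:\pi,E)\leadsto_{\mathtt{ue}}(D,\bar u^{\alpha},\phi^l:\pi,E)$ if $E=E_1[x\leftarrow\bar u^{\mathsf v}]E_2$, where $\bar u^\alpha$ is any code $\alpha$-equivalent to $\bar u$ that preserves well-naming of the machine (the choice of fresh names is considered irrelevant for determinism). Decoding (labels ignored): $\underline\epsilon=\langle\cdot\rangle$; $\underline{\phi:\pi}=\underline\pi\langle\langle\cdot\rangle\underline\phi\rangle$; a stack item that is a code decodes to itself, and $\underline{(\bar t,\pi)}=\underline\pi\langle\bar t\rangle$ for a stack item that is a pair; $\underline{D:(\bar t,\pi)}=\underline D\langle\underline\pi\langle\bar t\langle\cdot\rangle\rangle\rangle$; $\underline{[x\leftarrow\phi]:E}=\underline E\langle\langle\cdot\rangle[x\leftarrow\underline\phi]\rangle$; $\underline{(D,\bar t,\pi,E)}=\underline E\langle\underline D\langle\underline\pi\langle\bar t\rangle\rangle\rangle$. **Distilleries.** $(M,\multimap,\equiv,\underline{\,\cdot\,})$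 is a distillery if: $M$ is a machine with a deterministic labelled transition system on states, a class of initial states in bijection with closed $\lambda$-terms, and transitions partitioned into principal and commutative; $\multimap$ is a deterministic strategy on terms; $\equiv$ is an equivalence on terms that is a strong bisimulation w.r.t. $\multimap$ preserving the kind of rule (if $t\equiv u$ and $t\multimap_{\mathtt x}t'$ then there is $u'$ with $u\multimap_{\mathtt x}u'$ and $t'\equiv u'$); and $\underline{\,\cdot\,}$ maps states to terms so that, on reachable states, $s\leadsto s'$ implies $\underline s\multimap\equiv\underline{s'}$ for principal transitions and $\underline s\equiv\underline{s'}$ for commutative ones. It is reflective if on reachable states commutative transitions terminate and, whenever $\underline s$ is $\multimap$-reducible, $s$ is not final (some transition applies). It is explicit if principal transitions are partitioned into multiplicative and exponential ones, as for the strategy, and these decode to multiplicative, resp. exponential, $\multimap$-steps followed by $\equiv$. For the GLAMoUr, $c_1,\dots,c_5$ are commutative, $\mathtt{um}$ is multiplicative and $\mathtt{ue}$ is exponential.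
   Formalization: Strong bisimulation is stated for terms derived from λ-terms by ⊸uf and ≡ (on all terms it fails: I (I[x←δδ]) reduces, (I I)[x←δδ] does not), and machine determinism for reachable states (it fails if an environment binds a variable twice). -}

module Defs where

open import Data.Nat using (ℕ; zero; suc; _+_; _≟_)
open import Data.List using (List; []; _∷_; _++_)
open import Data.List.Relation.Unary.Unique.Propositional using (Unique)
open import Data.Product using (∃-syntax; _×_)
open import Data.Sum using (_⊎_)
open import Data.Empty using (⊥)
open import Induction.WellFounded using (Acc)
open import Relation.Nullary using (¬_; yes; no)
open import Relation.Binary using (IsEquivalence)
open import Relation.Binary.PropositionalEquality using (_≡_)
open import Relation.Binary.Construct.Closure.ReflexiveTransitive using (Star)

Name : Set
Name = ℕ

data Kind : Set where
  multiplicative exponential : Kind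

data Role : Set where
  commutative : Role
  principal   : Kind → Role

module Calculus (Sym : Set) where

  -- Terms with explicit substitutions up to α, in de Bruijn form: `lam t` and
  -- `es t u` (that is, t[x←u]) bind index 0 of t.  Names are natural numbers,
  -- and a free variable of name x is the index x (shifted by the number of
  -- binders above it), so that each α-class of named terms, open or closed,
  -- is exactly one element of Tm.
  data Tm : Set where
    var : ℕ → Tm
    cst : Sym → Tm
    lam : Tm → Tm
    app : Tm → Tm → Tm
    es  : Tm → Tm → Tm

  data IsλTerm : Tm → Set where
    var : ∀ x → IsλTerm (var x)
    cst : ∀ a → IsλTerm (cst a)
    lam : ∀ {t} → IsλTerm t → IsλTerm (lam t)
    app : ∀ {t u} → IsλTerm t → IsλTerm u → IsλTerm (app t u)

  _∈fv_ : ℕ → Tm → Set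
  x ∈fv var y   = x ≡ y
  x ∈fv cst a   = ⊥
  x ∈fv lam t   = suc x ∈fv t
  x ∈fv app t u = x ∈fv t ⊎ x ∈fv u
  x ∈fv es t u  = suc x ∈fv t ⊎ x ∈fv u

  Closed : Tm → Set
  Closed t = ∀ x → ¬ (x ∈fv t)

  ext : (ℕ → ℕ) → ℕ → ℕ
  ext ρ zero    = zero
  ext ρ (suc x) = suc (ρ x)

  ren : (ℕ → ℕ) → Tm → Tm
  ren ρ (var x)   = var (ρ x)
  ren ρ (cst a)   = cst a
  ren ρ (lam t)   = lam (ren (ext ρ) t)
  ren ρ (app t u) = app (ren ρ t) (ren ρ u)
  ren ρ (es t u)  = es (ren (ext ρ) t) (ren ρ u)

  wk : ℕ → Tm → Tm
  wk k = ren (k +_)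

  exts : (ℕ → Tm) → ℕ → Tm
  exts σ zero    = var zero
  exts σ (suc x) = wk 1 (σ x)

  sub : (ℕ → Tm) → Tm → Tm
  sub σ (var x)   = σ x
  sub σ (cst a)   = cst a
  sub σ (lam t)   = lam (sub (exts σ) t)
  sub σ (app t u) = app (sub σ t) (sub σ u)
  sub σ (es t u)  = es (sub (exts σ) t) (sub σ u)

  [0:=_] : Tm → ℕ → Tm
  [0:= u ] zero    = u
  [0:= u ] (suc x) = var x

  infix 30 _↓
  _↓ : Tm → Tm
  var x ↓   = var x
  cst a ↓   = cst a
  lam t ↓   = lam (t ↓)
  app t u ↓ = app (t ↓) (u ↓)
  es t u ↓  = sub [0:= u ↓ ] (t ↓)

  data Value : Tm → Set where
    lam : ∀ t → Value (lam t)

  -- Only ever used on unfoldings, which are λ-terms.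
  mutual
    data Fireball : Tm → Set where
      value : ∀ {t} → Value t → Fireball t
      inert : ∀ {t} → Inert t → Fireball t

    data Inert : Tm → Set where
      cst : ∀ a → Inert (cst a)
      app : ∀ {t u} → Inert t → Fireball u → Inert (app t u)

  data SubCtx : Set where
    □   : SubCtx
    esL : SubCtx → Tm → SubCtx

  data ShCtx : Set where
    □    : ShCtx
    appL : ShCtx → Tm → ShCtx
    appR : Tm → ShCtx → ShCtx
    esL  : ShCtx → Tm → ShCtx

  ⌈_⌉ : SubCtx → ShCtx
  ⌈ □ ⌉       = □
  ⌈ esL L t ⌉ = esL ⌈ L ⌉ t

  -- The number of binders above the hole.
  depth : ShCtx → ℕ
  depth □          = zero
  depth (appL S t) = depth S
  depth (appR t S) = depth S
  depth (esL S t)  = suc (depth S)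

  infix 25 _⟨_⟩
  _⟨_⟩ : ShCtx → Tm → Tm
  □        ⟨ t ⟩ = t
  appL S u ⟨ t ⟩ = app (S ⟨ t ⟩) u
  appR u S ⟨ t ⟩ = app u (S ⟨ t ⟩)
  esL S u  ⟨ t ⟩ = es (S ⟨ t ⟩) u

  infixr 26 _∘_
  _∘_ : ShCtx → ShCtx → ShCtx
  □        ∘ S' = S'
  appL S u ∘ S' = appL (S ∘ S') u
  appR u S ∘ S' = appR u (S ∘ S')
  esL S u  ∘ S' = esL (S ∘ S') u

  renCtx : (ℕ → ℕ) → ShCtx → ShCtx
  renCtx ρ □          = □
  renCtx ρ (appL S t) = appL (renCtx ρ S) (ren ρ t)
  renCtx ρ (appR t S) = appR (ren ρ t) (renCtx ρ S)
  renCtx ρ (esL S t)  = esL (renCtx (ext ρ) S) (ren ρ t)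

  subCtx : (ℕ → Tm) → ShCtx → ShCtx
  subCtx σ □          = □
  subCtx σ (appL S t) = appL (subCtx σ S) (sub σ t)
  subCtx σ (appR t S) = appR (sub σ t) (subCtx σ S)
  subCtx σ (esL S t)  = esL (subCtx (exts σ) S) (sub σ t)

  infix 30 _↓[_]
  _↓[_] : Tm → ShCtx → Tm
  t ↓[ □ ]        = t ↓
  t ↓[ appL S u ] = t ↓[ S ]
  t ↓[ appR u S ] = t ↓[ S ]
  t ↓[ esL S u ]  = sub [0:= u ↓ ] (t ↓[ S ])

  swap : ℕ → ℕ
  swap zero          = suc zero
  swap (suc zero)    = zero
  swap (suc (suc x)) = suc (suc x)

  -- Structural equivalence.  A side condition x ∉ fv(t) is rendered by writing
  -- t as a weakening at x.  The last four rules are closure under weak contexts,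
  -- one layer at a time.
  infix 10 _≋_
  data _≋_ : Tm → Tm → Set where
    com    : ∀ t u w → es (es t (wk 1 u)) w ≋ es (es (ren swap t) (wk 1 w)) u
    distR  : ∀ t w u → es (app (wk 1 t) w) u ≋ app t (es w u)
    distL  : ∀ t w u → es (app t (wk 1 w)) u ≋ app (es t u) w
    nest   : ∀ t u w → es (es (ren (ext suc) t) u) w ≋ es t (es u w)
    ≋-refl  : ∀ {t} → t ≋ t
    ≋-sym   : ∀ {t u} → t ≋ u → u ≋ t
    ≋-trans : ∀ {t u w} → t ≋ u → u ≋ w → t ≋ w
    appL   : ∀ {t t'} u → t ≋ t' → app t u ≋ app t' u
    appR   : ∀ t {u u'} → u ≋ u' → app t u ≋ app t u'
    esL    : ∀ {t t'} u → t ≋ t' → es t u ≋ es t' u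
    esR    : ∀ t {u u'} → u ≋ u' → es t u ≋ es t u'

  data Evaluable : ShCtx → Set where
    □    : Evaluable □
    appL : ∀ {S t} → Evaluable S → Fireball (t ↓) → Evaluable (appL S t)
    appR : ∀ {t S} → Evaluable S → Evaluable (appR t S)
    esL  : ∀ {S t} → Fireball (t ↓) → Evaluable (subCtx [0:= t ↓ ] S) → Evaluable (esL S t)

  Applicative : ShCtx → Set
  Applicative S = ∃[ S' ] ∃[ L ] ∃[ u ] S ≡ S' ∘ appL ⌈ L ⌉ u

  Useful : ShCtx → Set
  Useful S = Evaluable S × Applicative S

  -- The weakenings bring a subterm under the binders it is moved across.  In um,
  -- u enters the scope of L.  In ue, u is copied below the displayed binder and
  -- those of S', and S' (whose index 0 is the displayed x) enters the scope of L.
  infix 10 _⊸[_]_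
  data _⊸[_]_ : Tm → Kind → Tm → Set where
    um : ∀ S L t u →
         Useful (S ∘ appL ⌈ L ⌉ u) →
         S ⟨ app (⌈ L ⌉ ⟨ lam t ⟩) u ⟩
           ⊸[ multiplicative ]
         S ⟨ ⌈ L ⌉ ⟨ es t (wk (depth ⌈ L ⌉) u) ⟩ ⟩
    ue : ∀ S S' L u →
         Useful (S ∘ esL S' (⌈ L ⌉ ⟨ u ⟩)) →
         ¬ (∃[ u' ] ∃[ w ] u ≡ es u' w) →
         Value (u ↓[ S ∘ ⌈ L ⌉ ]) →
         S ⟨ es (S' ⟨ var (depth S') ⟩) (⌈ L ⌉ ⟨ u ⟩) ⟩
           ⊸[ exponential ]
         S ⟨ ⌈ L ⌉ ⟨ es (renCtx (ext (depth ⌈ L ⌉ +_)) S' ⟨ wk (suc (depth S')) u ⟩) u ⟩ ⟩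

  -- _≈_ is identity of states up to the choice of fresh names.
  record Machine : Set₁ where
    field
      State   : Set
      Label   : Set
      _⇝[_]_  : State → Label → State → Set
      role    : Label → Role
      Initial : State → Set
      _≈_     : State → State → Set

    Reachable : State → Set
    Reachable s = ∃[ s₀ ] Initial s₀ × Star (λ s₁ s₂ → ∃[ l ] s₁ ⇝[ l ] s₂) s₀ s

    -- Oriented as required by Acc: the reduct is on the left.
    CommutesFrom : State → State → Set
    CommutesFrom s' s = ∃[ l ] (role l ≡ commutative × s ⇝[ l ] s')

  module Distilleries
    (M : Machine)
    (_⊸⟨_⟩_ : Tm → Kind → Tm → Set)
    (_∼_ : Tm → Tm → Set)
    (decode : Machine.State M → Tm)
    where

    open Machine M

    -- The terms that arise when evaluating λ-terms, up to ∼.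
    Derivable : Tm → Set
    Derivable t = ∃[ t₀ ] IsλTerm t₀ × Star (λ u w → (∃[ k ] u ⊸⟨ k ⟩ w) ⊎ u ∼ w) t₀ t

    record IsDistillery : Set where
      field
        machine-deterministic : ∀ {s l₁ l₂ s₁ s₂} → Reachable s →
          s ⇝[ l₁ ] s₁ → s ⇝[ l₂ ] s₂ → l₁ ≡ l₂ × s₁ ≈ s₂
        initial-λTerm : ∀ {s} → Initial s → IsλTerm (decode s) × Closed (decode s)
        initial-injective : ∀ {s s'} → Initial s → Initial s' → decode s ≡ decode s' → s ≈ s'
        initial-surjective : ∀ t → IsλTerm t → Closed t → ∃[ s ] Initial s × decode s ≡ t
        strategy-deterministic : ∀ {t k₁ k₂ t₁ t₂} →
          t ⊸⟨ k₁ ⟩ t₁ → t ⊸⟨ k₂ ⟩ t₂ → k₁ ≡ k₂ × t₁ ≡ t₂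
        ∼-isEquivalence : IsEquivalence _∼_
        -- On arbitrary terms this fails for structural equivalence and the
        -- useful strategy: with I = λy.y and δδ not a fireball, the term
        -- I (I[x←δδ]) reduces, but (I I)[x←δδ] does not.
        ∼-strongBisimulation : ∀ {t u k t'} → Derivable t →
          t ∼ u → t ⊸⟨ k ⟩ t' → ∃[ u' ] u ⊸⟨ k ⟩ u' × t' ∼ u'
        principal-decodes : ∀ {s l k s'} → Reachable s →
          role l ≡ principal k → s ⇝[ l ] s' →
          ∃[ k' ] ∃[ t ] decode s ⊸⟨ k' ⟩ t × t ∼ decode s'
        commutative-decodes : ∀ {s l s'} → Reachable s →
          role l ≡ commutative → s ⇝[ l ] s' → decode s ∼ decode s'

    record IsReflective : Set where
      field
        commutative-terminates : ∀ {s} → Reachable s → Acc CommutesFrom s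
        progress : ∀ {s k t} → Reachable s → decode s ⊸⟨ k ⟩ t →
          ∃[ l ] ∃[ s' ] s ⇝[ l ] s'

    record IsExplicit : Set where
      field
        principal-preserves-kind : ∀ {s l k s'} → Reachable s →
          role l ≡ principal k → s ⇝[ l ] s' →
          ∃[ t ] decode s ⊸⟨ k ⟩ t × t ∼ decode s'

    record IsReflectiveExplicitDistillery : Set where
      field
        isDistillery : IsDistillery
        isReflective : IsReflective
        isExplicit   : IsExplicit

  data Code : Set where
    var : Name → Code
    cst : Sym → Code
    ƛ   : Name → Code → Code
    app : Code → Code → Code

  capture : Name → ℕ → ℕ
  capture x y with y ≟ x
  ... | yes _ = zero
  ... | no  _ = suc y

  -- Turns the free variable named x into index 0, for use under a binder.
  bind : Name → Tm → Tm
  bind x = ren (capture x)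

  -- The λ-term denoted by a code, i.e. its α-class.
  ⌊_⌋ : Code → Tm
  ⌊ var x ⌋   = var x
  ⌊ cst a ⌋   = cst a
  ⌊ ƛ x t ⌋   = lam (bind x ⌊ t ⌋)
  ⌊ app t u ⌋ = app ⌊ t ⌋ ⌊ u ⌋

  infix 10 _=α_
  _=α_ : Code → Code → Set
  t =α u = ⌊ t ⌋ ≡ ⌊ u ⌋

  data Lab : Set where
    𝗏 𝖠 : Lab

  infixr 20 _^_∷_
  mutual
    data Item : Set where
      code : Code → Item
      pair : Code → Stack → Item

    data Stack : Set where
      ε     : Stack
      _^_∷_ : Item → Lab → Stack → Stack

  -- The last pushed entry is the rightmost one.
  infixl 20 _∶⟨_,_⟩
  data Dump : Set where
    ε        : Dump
    _∶⟨_,_⟩ : Dump → Code → Stack → Dump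

  infix 21 [_←_^_]
  data Entry : Set where
    [_←_^_] : Name → Item → Lab → Entry

  Env : Set
  Env = List Entry

  record State : Set where
    constructor st
    field
      dump  : Dump
      focus : Code
      stack : Stack
      env   : Env

  bnCode : Code → List Name
  bnCode (var x)   = []
  bnCode (cst a)   = []
  bnCode (ƛ x t)   = x ∷ bnCode t
  bnCode (app t u) = bnCode t ++ bnCode u

  mutual
    bnItem : Item → List Name
    bnItem (code t)   = bnCode t
    bnItem (pair t π) = bnCode t ++ bnStack π

    bnStack : Stack → List Name
    bnStack ε           = []
    bnStack (φ ^ l ∷ π) = bnItem φ ++ bnStack π

  bnDump : Dump → List Name
  bnDump ε               = []
  bnDump (D ∶⟨ t , π ⟩) = bnDump D ++ bnCode t ++ bnStack π

  bnEnv : Env → List Name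
  bnEnv []                  = []
  bnEnv ([ x ← φ ^ l ] ∷ E) = x ∷ bnItem φ ++ bnEnv E

  -- All bound names, counting the variables bound by the environment, are distinct.
  WellNamed : State → Set
  WellNamed (st D t π E) = Unique (bnDump D ++ bnCode t ++ bnStack π ++ bnEnv E)

  data MLabel : Set where
    c₁ c₂ c₃ c₄ c₅ um ue : MLabel

  mrole : MLabel → Role
  mrole c₁ = commutative
  mrole c₂ = commutative
  mrole c₃ = commutative
  mrole c₄ = commutative
  mrole c₅ = commutative
  mrole um = principal multiplicative
  mrole ue = principal exponential

  data Transition : State → MLabel → State → Set where
    c₁ : ∀ {D t u π E} →
         Transition (st D (app t u) π E) c₁ (st (D ∶⟨ t , π ⟩) u ε E)
    um : ∀ {D x t φ l π E} →
         Transition (st D (ƛ x t) (φ ^ l ∷ π) E) um (st D t π ([ x ← φ ^ l ] ∷ E))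
    c₂ : ∀ {D t π x u E} →
         Transition (st (D ∶⟨ t , π ⟩) (ƛ x u) ε E) c₂ (st D t (code (ƛ x u) ^ 𝗏 ∷ π) E)
    c₃ : ∀ {D t π a π' E} →
         Transition (st (D ∶⟨ t , π ⟩) (cst a) π' E) c₃ (st D t (pair (cst a) π' ^ 𝖠 ∷ π) E)
    c₄ : ∀ {D t π x π' E} E₁ φ E₂ → E ≡ E₁ ++ [ x ← φ ^ 𝖠 ] ∷ E₂ →
         Transition (st (D ∶⟨ t , π ⟩) (var x) π' E) c₄ (st D t (pair (var x) π' ^ 𝖠 ∷ π) E)
    c₅ : ∀ {D t π x E} E₁ u E₂ → E ≡ E₁ ++ [ x ← code u ^ 𝗏 ] ∷ E₂ →
         Transition (st (D ∶⟨ t , π ⟩) (var x) ε E) c₅ (st D t (code (var x) ^ 𝗏 ∷ π) E)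
    ue : ∀ {D x φ l π E} E₁ u E₂ uᵅ → E ≡ E₁ ++ [ x ← code u ^ 𝗏 ] ∷ E₂ →
         uᵅ =α u → WellNamed (st D uᵅ (φ ^ l ∷ π) E) →
         Transition (st D (var x) (φ ^ l ∷ π) E) ue (st D uᵅ (φ ^ l ∷ π) E)

  data InitialState : State → Set where
    initial : ∀ t → Closed ⌊ t ⌋ → Unique (bnCode t) → InitialState (st ε t ε [])

  data SameUpToα : State → State → Set where
    focusα : ∀ {D t u π E} → t =α u → SameUpToα (st D t π E) (st D u π E)

  GLAMoUr : Machine
  GLAMoUr = record
    { State   = State
    ; Label   = MLabel
    ; _⇝[_]_  = Transition
    ; role    = mrole
    ; Initial = InitialState
    ; _≈_     = SameUpToα
    }

  -- The contexts decoding stacks, dumps and environments are given as the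
  -- function that plugs a term in their hole.
  mutual
    decodeItem : Item → Tm
    decodeItem (code t)   = ⌊ t ⌋
    decodeItem (pair t π) = decodeStack π ⌊ t ⌋

    decodeStack : Stack → Tm → Tm
    decodeStack ε           h = h
    decodeStack (φ ^ l ∷ π) h = decodeStack π (app h (decodeItem φ))

  decodeDump : Dump → Tm → Tm
  decodeDump ε               h = h
  decodeDump (D ∶⟨ t , π ⟩) h = decodeDump D (decodeStack π (app ⌊ t ⌋ h))

  decodeEnv : Env → Tm → Tm
  decodeEnv []                  h = h
  decodeEnv ([ x ← φ ^ l ] ∷ E) h = decodeEnv E (es (bind x h) (decodeItem φ))

  decode : State → Tm
  decode (st D t π E) = decodeEnv E (decodeDump D (decodeStack π ⌊ t ⌋))

{-# OPTIONS --safe #-}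
module Submission where

-- Whether an unfolding is a value, an inert term or not a fireball depends only on these
-- statuses for the terms substituted in it, and is computed by a function (stat) that
-- needs no substitution.  With it, the strategy becomes an inductive relation (Step) in
-- which a redex at a distance is a redex up to moving substitutions outwards, and the
-- replacement of one variable occurrence is a third kind of action besides the two
-- rules.  A term that reduces does not unfold to a fireball, which gives determinism and,
-- on the machine side, progress.  Each axiom of structural equivalence is a simulation
-- in both directions for this relation, on all terms; the evaluation of a λ-term only
-- substitutes fireballs, and on terms with this property the relation is the strategy.
-- On reachable states the labels are the statuses of the decoded items, all free names
-- are in the domain of the environment and all bound names are distinct, so no capture
-- occurs when substitutions are moved to the environment.

open import Defs
open import Data.Nat using (ℕ; zero; suc; _+_; _≤_; _<_; _≟_; _⊔_)
open import Data.Nat.Induction using (<-wellFounded)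
open import Data.Nat.Properties using (+-suc; +-assoc; +-identityʳ; suc-injective; ≤-refl; ≤-reflexive; ≤-trans; <-irrefl; <⇒≤; n≤1+n; n<1+n; m<n⇒m<1+n; m≤m⊔n; m≤n⊔m)
open import Data.List using (List; []; _∷_; _++_)
open import Data.List.Properties using (++-identityʳ; ∷-injectiveʳ)
open import Data.List.Membership.Propositional using (_∈_)
open import Data.List.Relation.Unary.All as All using (All; []; _∷_)
open import Data.List.Relation.Unary.All.Properties using (++⁺; ++⁻ʳ)
open import Data.List.Relation.Unary.AllPairs using ([]; _∷_)
open import Data.List.Relation.Unary.Any using (here; there)
open import Data.List.Relation.Unary.Unique.Propositional using (Unique)
open import Data.List.Relation.Unary.Unique.Propositional.Properties using () renaming (++⁺ to unique-++⁺)
open import Data.Product using (_×_; _,_; proj₁; proj₂; ∃-syntax)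
open import Data.Sum using (_⊎_; inj₁; inj₂; map₂)
open import Data.Sum.Properties using (inj₂-injective)
open import Data.Empty using (⊥-elim)
open import Data.Unit using (⊤; tt)
open import Induction.WellFounded using (Acc; module Subrelation)
open import Relation.Nullary using (¬_; yes; no)
open import Relation.Binary.Construct.Closure.ReflexiveTransitive using (Star; ε; _◅_)
open import Relation.Binary.Construct.On using (accessible)
open import Relation.Binary.PropositionalEquality using (_≡_; _≢_; refl; sym; trans; cong; cong₂; subst; subst₂; setoid)
open import Data.List.Relation.Binary.Permutation.Setoid (setoid ℕ) using (↭-refl)
open import Data.List.Relation.Binary.Permutation.Setoid.Properties (setoid ℕ) using (Unique-resp-↭; ++-commutativeMonoid)
open import Algebra.Solver.CommutativeMonoid ++-commutativeMonoid using (solve; _⊜_; _⊕_)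

module Proof (Sym : Set) where
  open Calculus Sym

  -- Renaming

  ext-comm : ∀ {ρ₁ ρ₂ ρ₃ ρ₄} → (∀ x → ρ₁ (ρ₂ x) ≡ ρ₃ (ρ₄ x)) →
             ∀ x → ext ρ₁ (ext ρ₂ x) ≡ ext ρ₃ (ext ρ₄ x)
  ext-comm e zero    = refl
  ext-comm e (suc x) = cong suc (e x)

  ext-id : ∀ {ρ} → (∀ x → ρ x ≡ x) → ∀ x → ext ρ x ≡ x
  ext-id e zero    = refl
  ext-id e (suc x) = cong suc (e x)

  ren-comm : ∀ {ρ₁ ρ₂ ρ₃ ρ₄} → (∀ x → ρ₁ (ρ₂ x) ≡ ρ₃ (ρ₄ x)) →
             ∀ t → ren ρ₁ (ren ρ₂ t) ≡ ren ρ₃ (ren ρ₄ t)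
  ren-comm e (var x)   = cong var (e x)
  ren-comm e (cst a)   = refl
  ren-comm e (lam t)   = cong lam (ren-comm (ext-comm e) t)
  ren-comm e (app t u) = cong₂ app (ren-comm e t) (ren-comm e u)
  ren-comm e (es t u)  = cong₂ es (ren-comm (ext-comm e) t) (ren-comm e u)

  ren-id : ∀ {ρ} → (∀ x → ρ x ≡ x) → ∀ t → ren ρ t ≡ t
  ren-id e (var x)   = cong var (e x)
  ren-id e (cst a)   = refl
  ren-id e (lam t)   = cong lam (ren-id (ext-id e) t)
  ren-id e (app t u) = cong₂ app (ren-id e t) (ren-id e u)
  ren-id e (es t u)  = cong₂ es (ren-id (ext-id e) t) (ren-id e u)

  ren-ren : ∀ {ρ₁ ρ₂ ρ₃} → (∀ x → ρ₁ (ρ₂ x) ≡ ρ₃ x) →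
            ∀ t → ren ρ₁ (ren ρ₂ t) ≡ ren ρ₃ t
  ren-ren e t = trans (ren-comm {ρ₄ = λ x → x} e t) (cong (ren _) (ren-id (λ _ → refl) t))

  ren-wk : ∀ ρ t → ren (ext ρ) (wk 1 t) ≡ wk 1 (ren ρ t)
  ren-wk ρ = ren-comm (λ _ → refl)

  ren-up : ∀ ρ t → ren (ext (ext ρ)) (ren (ext suc) t) ≡ ren (ext suc) (ren (ext ρ) t)
  ren-up ρ = ren-comm (ext-comm (λ _ → refl))

  swap-ext : ∀ ρ x → ext (ext ρ) (swap x) ≡ swap (ext (ext ρ) x)
  swap-ext ρ zero          = refl
  swap-ext ρ (suc zero)    = refl
  swap-ext ρ (suc (suc x)) = refl

  swap-swap : ∀ x → swap (swap x) ≡ x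
  swap-swap zero          = refl
  swap-swap (suc zero)    = refl
  swap-swap (suc (suc x)) = refl

  ren-swap-swap : ∀ t → ren swap (ren swap t) ≡ t
  ren-swap-swap t = trans (ren-ren swap-swap t) (ren-id (λ _ → refl) t)

  swap-up : ∀ x → swap (ext suc x) ≡ suc x
  swap-up zero    = refl
  swap-up (suc x) = refl

  swap-wk : ∀ x → swap (suc x) ≡ ext suc x
  swap-wk zero    = refl
  swap-wk (suc x) = refl

  ext-suc-inj : ∀ {x y} → ext suc x ≡ ext suc y → x ≡ y
  ext-suc-inj {zero}  {zero}  e = refl
  ext-suc-inj {suc x} {suc y} e = suc-injective e

  -- Statuses

  -- The shape of an unfolding, where each variable stands for a λ-term of known status:
  -- a value, an inert term, or (none) not a fireball.
  data Status : Set where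
    none val inert : Status

  infixr 5 _∙_
  _∙_ : Status → (ℕ → Status) → ℕ → Status
  (s ∙ γ) zero    = s
  (s ∙ γ) (suc x) = γ x

  appS : Status → Status → Status
  appS none  s     = none
  appS val   s     = none
  appS inert none  = none
  appS inert val   = inert
  appS inert inert = inert

  stat : (ℕ → Status) → Tm → Status
  stat γ (var x)   = γ x
  stat γ (cst a)   = inert
  stat γ (lam t)   = val
  stat γ (app t u) = appS (stat γ t) (stat γ u)
  stat γ (es t u)  = stat (stat γ u ∙ γ) t

  appS≢val : ∀ s s' → appS s s' ≢ val
  appS≢val inert none  ()
  appS≢val inert val   ()
  appS≢val inert inert ()

  appS-none : ∀ s → appS s none ≡ none
  appS-none none  = refl
  appS-none val   = refl
  appS-none inert = refl

  appS-head : ∀ s s' → s ≢ inert → appS s s' ≡ none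
  appS-head none  s' p = refl
  appS-head val   s' p = refl
  appS-head inert s' p = ⊥-elim (p refl)

  appS-inert : ∀ s → s ≢ none → appS inert s ≡ inert
  appS-inert none  p = ⊥-elim (p refl)
  appS-inert val   p = refl
  appS-inert inert p = refl

  Along : (ℕ → ℕ) → (ℕ → Status) → (ℕ → Status) → Set
  Along ρ γ γ' = ∀ x → γ x ≡ γ' (ρ x)

  along-ext : ∀ {ρ γ γ' s s'} → s ≡ s' → Along ρ γ γ' → Along (ext ρ) (s ∙ γ) (s' ∙ γ')
  along-ext p e zero    = p
  along-ext p e (suc x) = e x

  stat-ren : ∀ {ρ γ γ'} → Along ρ γ γ' → ∀ t → stat γ t ≡ stat γ' (ren ρ t)
  stat-ren e (var x)   = e x
  stat-ren e (cst a)   = refl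
  stat-ren e (lam t)   = refl
  stat-ren e (app t u) = cong₂ appS (stat-ren e t) (stat-ren e u)
  stat-ren e (es t u)  = stat-ren (along-ext (stat-ren e u) e) t

  stat-wk : ∀ γ s t → stat (s ∙ γ) (wk 1 t) ≡ stat γ t
  stat-wk γ s t = sym (stat-ren (λ _ → refl) t)

  along-swap : ∀ {γ s s' r r'} → s ≡ s' → r ≡ r' → Along swap (s ∙ r ∙ γ) (r' ∙ s' ∙ γ)
  along-swap p q zero          = p
  along-swap p q (suc zero)    = q
  along-swap p q (suc (suc x)) = refl

  along-up : ∀ {γ s r r'} → r ≡ r' → Along (ext suc) (r ∙ γ) (r' ∙ s ∙ γ)
  along-up p = along-ext p (λ _ → refl)

  stat-≋ : ∀ {t u} → t ≋ u → ∀ γ → stat γ t ≡ stat γ u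
  stat-≋ (com t u w) γ =
    stat-ren (along-swap (stat-wk γ _ u) (sym (stat-wk γ _ w))) t
  stat-≋ (distR t w u) γ = cong (λ s → appS s _) (stat-wk γ _ t)
  stat-≋ (distL t w u) γ = cong (appS _) (stat-wk γ _ w)
  stat-≋ (nest t u w) γ = sym (stat-ren (along-up refl) t)
  stat-≋ ≋-refl γ = refl
  stat-≋ (≋-sym p) γ = sym (stat-≋ p γ)
  stat-≋ (≋-trans p q) γ = trans (stat-≋ p γ) (stat-≋ q γ)
  stat-≋ (appL u p) γ = cong (λ s → appS s _) (stat-≋ p γ)
  stat-≋ (appR t p) γ = cong (appS _) (stat-≋ p γ)
  stat-≋ (esL u p) γ = stat-≋ p _
  stat-≋ (esR t p) γ = cong (λ s → stat (s ∙ γ) t) (stat-≋ p γ)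

  -- The strategy, inductively

  data Mode : Set where
    top hd : Mode

  -- rep n v replaces an occurrence of the variable n by v.
  data Act : Set where
    β   : Kind → Act
    rep : ℕ → Tm → Act

  renA : (ℕ → ℕ) → Act → Act
  renA ρ (β k)     = β k
  renA ρ (rep n v) = rep (ρ n) (ren ρ v)

  renA-comm : ∀ {ρ₁ ρ₂ ρ₃ ρ₄} → (∀ x → ρ₁ (ρ₂ x) ≡ ρ₃ (ρ₄ x)) →
              ∀ κ → renA ρ₁ (renA ρ₂ κ) ≡ renA ρ₃ (renA ρ₄ κ)
  renA-comm e (β k)     = refl
  renA-comm e (rep n v) = cong₂ rep (e n) (ren-comm e v)

  renA-id : ∀ {ρ} → (∀ x → ρ x ≡ x) → ∀ κ → renA ρ κ ≡ κ
  renA-id e (β k)     = refl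
  renA-id e (rep n v) = cong₂ rep (e n) (ren-id e v)

  data Bare : Tm → Set where
    var : ∀ x → Bare (var x)
    lam : ∀ t → Bare (lam t)

  -- UM t u r: the application t u is a multiplicative redex at a distance, with reduct r.
  data UM : Tm → Tm → Tm → Set where
    here : ∀ {b u} → UM (lam b) u (es b u)
    esL  : ∀ {t w u r} → UM t (wk 1 u) r → UM (es t w) u (es r w)

  -- Step m γ κ t t' drops the requirement that substituted terms be fireballs, which makes
  -- it invariant under ≋ on all terms.  In mode hd, the term is applied, up to a
  -- substitution context, so that a variable in head position may be replaced.
  -- UE m γ t u r: the term t[0←u] is an exponential redex, with reduct r.
  mutual
    data Step : Mode → (ℕ → Status) → Act → Tm → Tm → Set where
      here : ∀ {γ n v} → Step hd γ (rep n v) (var n) v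
      um   : ∀ {m γ t u r} → stat γ u ≢ none → UM t u r → Step m γ (β multiplicative) (app t u) r
      ue   : ∀ {m γ t u r} → UE m γ t u r → Step m γ (β exponential) (es t u) r
      appL : ∀ {m γ κ t t' u} → stat γ u ≢ none → Step hd γ κ t t' → Step m γ κ (app t u) (app t' u)
      appR : ∀ {m γ κ t u u'} → Step top γ κ u u' → Step m γ κ (app t u) (app t u')
      esL  : ∀ {m γ κ t t' u} → Step m (stat γ u ∙ γ) (renA suc κ) t t' → Step m γ κ (es t u) (es t' u)

    data UE : Mode → (ℕ → Status) → Tm → Tm → Tm → Set where
      here : ∀ {m γ t v t'} → Bare v → stat γ v ≡ val →
             Step m (stat γ v ∙ γ) (rep 0 (wk 1 v)) t t' → UE m γ t v (es t' v)
      esL  : ∀ {m γ t u w r} →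
             UE m (stat γ w ∙ γ) (ren (ext suc) t) u r → UE m γ t (es u w) (es r w)

  bare-ren : ∀ {v} ρ → Bare v → Bare (ren ρ v)
  bare-ren ρ (var x) = var _
  bare-ren ρ (lam t) = lam _

  bare-unren : ∀ {ρ} t → Bare (ren ρ t) → Bare t
  bare-unren (var x) b = var x
  bare-unren (lam t) b = lam t

  Step-act : ∀ {m γ κ κ' t t'} → κ ≡ κ' → Step m γ κ t t' → Step m γ κ' t t'
  Step-act refl s = s

  UE-body : ∀ {m γ t t' u r} → t ≡ t' → UE m γ t u r → UE m γ t' u r
  UE-body refl p = p

  UM-ren : ∀ {ρ t u r} → UM t u r → UM (ren ρ t) (ren ρ u) (ren ρ r)
  UM-ren here = here
  UM-ren {ρ} (esL {u = u} p) = esL (subst (λ z → UM _ z _) (ren-wk ρ u) (UM-ren p))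

  mutual
    Step-ren : ∀ {ρ m γ γ' κ t t'} → Along ρ γ γ' →
               Step m γ κ t t' → Step m γ' (renA ρ κ) (ren ρ t) (ren ρ t')
    Step-ren e here = here
    Step-ren e (um {u = u} f p) = um (λ q → f (trans (stat-ren e u) q)) (UM-ren p)
    Step-ren e (ue p) = ue (UE-ren e p)
    Step-ren e (appL {u = u} f s) = appL (λ q → f (trans (stat-ren e u) q)) (Step-ren e s)
    Step-ren e (appR s) = appR (Step-ren e s)
    Step-ren e (esL {κ = κ} {u = u} s) =
      esL (Step-act (renA-comm (λ _ → refl) κ) (Step-ren (along-ext (stat-ren e u) e) s))

    UE-ren : ∀ {ρ m γ γ' t u r} → Along ρ γ γ' →
             UE m γ t u r → UE m γ' (ren (ext ρ) t) (ren ρ u) (ren ρ r)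
    UE-ren {ρ} e (here {v = v} b p s) =
      here (bare-ren ρ b) (trans (sym (stat-ren e v)) p)
           (Step-act (cong (rep 0) (ren-wk ρ v)) (Step-ren (along-ext (stat-ren e v) e) s))
    UE-ren {ρ} e (esL {t = t} {w = w} p) =
      esL (UE-body (ren-up ρ t) (UE-ren (along-ext (stat-ren e w) e) p))

  shape : Act → Kind ⊎ ℕ
  shape (β k)     = inj₁ k
  shape (rep n v) = inj₂ n

  -- The shape of the action is reflected by ρ; the reduct is only when the action itself is.
  Reflects : (ℕ → ℕ) → Mode → (ℕ → Status) → Act → Tm → Tm → Set
  Reflects ρ m γ κ t r =
    ∃[ s ] (shape κ ≡ map₂ ρ s ×
            (∀ κ₀ → shape κ₀ ≡ s → ∃[ r₀ ] (Step m γ κ₀ t r₀ × (κ ≡ renA ρ κ₀ → r ≡ ren ρ r₀))))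

  UM-reflect : ∀ {ρ T U r} t u → UM T U r → T ≡ ren ρ t → U ≡ ren ρ u →
               ∃[ r₀ ] (UM t u r₀ × r ≡ ren ρ r₀)
  UM-reflect (lam b) u here refl refl = _ , here , refl
  UM-reflect {ρ} (es t w) u (esL p) refl refl
    with UM-reflect t (wk 1 u) p refl (sym (ren-wk ρ u))
  ... | r , q , refl = _ , esL q , refl

  mutual
    Step-reflect : ∀ {ρ m γ γ₀ κ T r} t → Along ρ γ₀ γ → Step m γ κ T r → T ≡ ren ρ t →
                   Reflects ρ m γ₀ κ t r
    Step-reflect (var n) e here refl = inj₂ n , refl , λ { (rep _ v₀) refl → v₀ , here , λ { refl → refl } }
    Step-reflect (app t u) e (um f p) refl with UM-reflect t u p refl refl
    ... | r , q , refl = inj₁ _ , refl , λ { (β _) refl → r , um (λ z → f (trans (sym (stat-ren e u)) z)) q , λ _ → refl }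
    Step-reflect (es t u) e (ue p) refl with UE-reflect t u e p refl refl
    ... | r , q , refl = inj₁ _ , refl , λ { (β _) refl → r , ue q , λ _ → refl }
    Step-reflect (app t u) e (appL f s) refl with Step-reflect t e s refl
    ... | sh , p , q = sh , p , λ κ₀ eq → let (r , s' , g) = q κ₀ eq in
          app r u , appL (λ z → f (trans (sym (stat-ren e u)) z)) s' , λ z → cong (λ z → app z _) (g z)
    Step-reflect (app t u) e (appR s) refl with Step-reflect u e s refl
    ... | sh , p , q = sh , p , λ κ₀ eq → let (r , s' , g) = q κ₀ eq in
          app t r , appR s' , λ z → cong (app _) (g z)
    Step-reflect {ρ} {κ = κ} (es t u) e (esL s) refl
      with κ | Step-reflect t (along-ext (stat-ren e u) e) s refl
    ... | β k | inj₁ .k , refl , q = inj₁ k , refl , λ { (β _) refl →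
          let (r , s' , g) = q (β k) refl in es r u , esL s' , λ z → cong (λ z → es z _) (g refl) }
    ... | rep n v | inj₂ (suc n₀) , refl , q = inj₂ n₀ , refl , λ { (rep _ v₀) refl →
          let (r , s' , g) = q (rep (suc n₀) (wk 1 v₀)) refl in
          es r u , esL s' , λ { refl → cong (λ z → es z _) (g (cong (rep _) (sym (ren-wk ρ v₀)))) } }

    UE-reflect : ∀ {ρ m γ γ₀ T U r} t u → Along ρ γ₀ γ → UE m γ T U r →
                 T ≡ ren (ext ρ) t → U ≡ ren ρ u → ∃[ r₀ ] (UE m γ₀ t u r₀ × r ≡ ren ρ r₀)
    UE-reflect {ρ} t u e (here b p s) refl eq = UE-reflect-here t u e b p s eq
    UE-reflect {ρ} t (es u w) e (esL p) refl refl
      with UE-reflect (ren (ext suc) t) u (along-ext (stat-ren e w) e) p (sym (ren-up ρ t)) refl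
    ... | r , q , refl = _ , esL q , refl

    UE-reflect-here : ∀ {ρ m γ γ₀ V r} t u → Along ρ γ₀ γ → Bare V → stat γ V ≡ val →
                 Step m (stat γ V ∙ γ) (rep 0 (wk 1 V)) (ren (ext ρ) t) r →
                 V ≡ ren ρ u → ∃[ r₀ ] (UE m γ₀ t u r₀ × es r V ≡ ren ρ r₀)
    UE-reflect-here {ρ} t u e b p s refl with Step-reflect t (along-ext (stat-ren e u) e) s refl
    ... | inj₂ zero , refl , q with q (rep 0 (wk 1 u)) refl
    ... | r , s' , g = es r u , here (bare-unren u b) (trans (stat-ren e u) p) s'
                     , cong (λ z → es z _) (g (cong (rep 0) (sym (ren-wk ρ u))))

  map₂-injective : ∀ {ρ : ℕ → ℕ} → (∀ {x y} → ρ x ≡ ρ y → x ≡ y) →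
                   ∀ (s s' : Kind ⊎ ℕ) → map₂ ρ s ≡ map₂ ρ s' → s ≡ s'
  map₂-injective i (inj₁ k) (inj₁ .k) refl = refl
  map₂-injective i (inj₂ n) (inj₂ n') eq   = cong inj₂ (i (inj₂-injective eq))

  shape-renA : ∀ ρ κ → shape (renA ρ κ) ≡ map₂ ρ (shape κ)
  shape-renA ρ (β k)     = refl
  shape-renA ρ (rep n v) = refl

  Step-unren : ∀ {ρ m γ γ₀ r} κ t → (∀ {x y} → ρ x ≡ ρ y → x ≡ y) → Along ρ γ₀ γ →
               Step m γ (renA ρ κ) (ren ρ t) r → ∃[ r₀ ] (Step m γ₀ κ t r₀ × r ≡ ren ρ r₀)
  Step-unren {ρ} κ t i e s with Step-reflect t e s refl
  ... | sh , p , q with q κ (map₂-injective i (shape κ) sh (trans (sym (shape-renA ρ κ)) p))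
  ... | r , s' , g = r , s' , g refl

  Step-image : ∀ {ρ m γ n v r} t → Step m γ (rep n v) (ren ρ t) r → ∃[ n₀ ] n ≡ ρ n₀
  Step-image t s with Step-reflect t (λ _ → refl) s refl
  ... | inj₂ n₀ , refl , _ = n₀ , refl

  UE-val : ∀ {m γ t u r} → UE m γ t u r → stat γ u ≡ val
  UE-val (here b p s) = p
  UE-val (esL p)      = UE-val p

  -- The occurrence replaced by an exponential step may be replaced by any term instead.
  UE-step : ∀ {m γ u r} t v → UE m γ t u r → ∃[ t' ] Step m (stat γ u ∙ γ) (rep 0 v) t t'
  UE-step t v (here b p s)
    with Step-reflect {ρ = λ x → x} t (λ _ → refl) s (sym (ren-id (λ _ → refl) t))
  ... | inj₂ .0 , refl , q with q (rep 0 v) refl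
  ... | r , s' , _ = r , s'
  UE-step t v (esL p) with UE-step (ren (ext suc) t) v p
  ... | _ , s with Step-reflect t (along-up refl) s refl
  ... | inj₂ zero , refl , q with q (rep 0 v) refl
  ... | r , s' , _ = r , s'

  -- Determinism of the strategy

  -- A necessary condition on the status of a term that reduces in the given mode.
  Reducible : Mode → Status → Set
  Reducible top s = s ≡ none
  Reducible hd  s = s ≢ inert

  reducible-none : ∀ m {s} → s ≡ none → Reducible m s
  reducible-none top p    = p
  reducible-none hd  refl ()

  ReplacesValue : (ℕ → Status) → Act → Set
  ReplacesValue γ (β k)     = ⊤
  ReplacesValue γ (rep n v) = γ n ≡ val

  replacesValue-suc : ∀ {γ s} κ → ReplacesValue γ κ → ReplacesValue (s ∙ γ) (renA suc κ)
  replacesValue-suc (β k)     p = tt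
  replacesValue-suc (rep n v) p = p

  UM-val : ∀ {γ t u r} → UM t u r → stat γ t ≡ val
  UM-val here    = refl
  UM-val (esL p) = UM-val p

  val≢inert : val ≢ inert
  val≢inert ()

  mutual
    Step-reducible : ∀ {m γ κ t t'} → ReplacesValue γ κ → Step m γ κ t t' → Reducible m (stat γ t)
    Step-reducible v here q with trans (sym v) q
    ... | ()
    Step-reducible {m} {γ} v (um {t = t} {u} f p) =
      reducible-none m (appS-head (stat γ t) (stat γ u) λ q → val≢inert (trans (sym (UM-val p)) q))
    Step-reducible v (ue {t = t} p) = UE-reducible t p
    Step-reducible {m} {γ} v (appL {t = t} {u = u} f s) =
      reducible-none m (appS-head (stat γ t) (stat γ u) (Step-reducible v s))
    Step-reducible {m} {γ} v (appR {t = t} s) =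
      reducible-none m (trans (cong (appS (stat γ t)) (Step-reducible v s)) (appS-none (stat γ t)))
    Step-reducible {κ = κ} v (esL s) = Step-reducible (replacesValue-suc κ v) s

    UE-reducible : ∀ {m γ u r} t → UE m γ t u r → Reducible m (stat (stat γ u ∙ γ) t)
    UE-reducible t (here b p s) = Step-reducible p s
    UE-reducible {m} t (esL p) =
      subst (Reducible m) (sym (stat-ren (along-up refl) t)) (UE-reducible (ren (ext suc) t) p)

  UM-deterministic : ∀ {t u r r'} → UM t u r → UM t u r' → r ≡ r'
  UM-deterministic here    here    = refl
  UM-deterministic (esL p) (esL q) = cong (λ r → es r _) (UM-deterministic p q)

  UM-normal : ∀ {t u r m γ κ t'} → UM t u r → ¬ Step m γ κ t t'
  UM-normal (esL p) (ue q)  = UM-normal p (proj₂ (UE-step _ (var 0) q))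
  UM-normal (esL p) (esL s) = UM-normal p s

  SameStep : Act → Act → Tm → Tm → Set
  SameStep κ κ' t t' = shape κ ≡ shape κ' × (κ ≡ κ' → t ≡ t')

  mutual
    Step-deterministic : ∀ {m γ κ κ' t₁ t₂} t ρ → ReplacesValue γ κ → ReplacesValue γ κ' →
      Step m γ κ (ren ρ t) t₁ → Step m γ κ' (ren ρ t) t₂ → SameStep κ κ' t₁ t₂
    Step-deterministic (var x) ρ v v' here here = refl , λ { refl → refl }
    Step-deterministic (app t u) ρ v v' (um f p) (um f' p') = refl , λ _ → UM-deterministic p p'
    Step-deterministic (app t u) ρ v v' (um f p) (appL f' s) = ⊥-elim (UM-normal p s)
    Step-deterministic (app t u) ρ v v' (um f p) (appR s) = ⊥-elim (f (Step-reducible v' s))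
    Step-deterministic (app t u) ρ v v' (appL f s) (um f' p) = ⊥-elim (UM-normal p s)
    Step-deterministic (app t u) ρ v v' (appL f s) (appL f' s') with Step-deterministic t ρ v v' s s'
    ... | p , q = p , λ e → cong (λ z → app z _) (q e)
    Step-deterministic (app t u) ρ v v' (appL f s) (appR s') = ⊥-elim (f (Step-reducible v' s'))
    Step-deterministic (app t u) ρ v v' (appR s) (um f p) = ⊥-elim (f (Step-reducible v s))
    Step-deterministic (app t u) ρ v v' (appR s) (appL f s') = ⊥-elim (f (Step-reducible v s))
    Step-deterministic (app t u) ρ v v' (appR s) (appR s') with Step-deterministic u ρ v v' s s'
    ... | p , q = p , λ e → cong (app _) (q e)
    Step-deterministic (es t u) ρ v v' (ue p) (ue q) = refl , λ _ → UE-deterministic t (ren ρ u) (ext ρ) p q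
    Step-deterministic {κ' = κ'} (es t u) ρ v v' (ue p) (esL s)
      with UE-step (ren (ext ρ) t) (var 0) p
    ... | _ , s' with Step-deterministic t (ext ρ) (UE-val p) (replacesValue-suc κ' v') s' s
    ... | e , _ = ⊥-elim (zero≢suc κ' e)
    Step-deterministic {κ = κ} (es t u) ρ v v' (esL s) (ue p)
      with UE-step (ren (ext ρ) t) (var 0) p
    ... | _ , s' with Step-deterministic t (ext ρ) (UE-val p) (replacesValue-suc κ v) s' s
    ... | e , _ = ⊥-elim (zero≢suc κ e)
    Step-deterministic {κ = κ} {κ'} (es t u) ρ v v' (esL s) (esL s')
      with Step-deterministic t (ext ρ) (replacesValue-suc κ v) (replacesValue-suc κ' v') s s'
    ... | p , q = map₂-injective suc-injective (shape κ) (shape κ')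
                    (trans (sym (shape-renA suc κ)) (trans p (shape-renA suc κ')))
                , λ { refl → cong (λ z → es z _) (q refl) }

    UE-deterministic : ∀ {m γ r r'} t u ρ → UE m γ (ren ρ t) u r → UE m γ (ren ρ t) u r' → r ≡ r'
    UE-deterministic t u ρ (here b p s) (here b' p' s') =
      cong (λ z → es z _) (proj₂ (Step-deterministic t ρ p p' s s') refl)
    UE-deterministic t (es u w) ρ (esL p) (esL q) =
      cong (λ z → es z _) (UE-deterministic t u (λ x → ext suc (ρ x)) (UE-body e p) (UE-body e q))
      where
      e = ren-ren (λ _ → refl) t

    zero≢suc : ∀ κ → inj₂ 0 ≢ shape (renA suc κ)
    zero≢suc (β k)     ()
    zero≢suc (rep n v) ()

  -- Bisimulation

  infix 10 _▷_
  data _▷_ : Tm → Tm → Set where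
    com    : ∀ t u w → es (es t (wk 1 u)) w ▷ es (es (ren swap t) (wk 1 w)) u
    distR  : ∀ t w u → es (app (wk 1 t) w) u ▷ app t (es w u)
    distL  : ∀ t w u → es (app t (wk 1 w)) u ▷ app (es t u) w
    nest   : ∀ t u w → es (es (ren (ext suc) t) u) w ▷ es t (es u w)

  ▷⇒≋ : ∀ {t u} → t ▷ u → t ≋ u
  ▷⇒≋ (com t u w)   = com t u w
  ▷⇒≋ (distR t w u) = distR t w u
  ▷⇒≋ (distL t w u) = distL t w u
  ▷⇒≋ (nest t u w)  = nest t u w

  ▷-ren : ∀ {t u} ρ → t ▷ u → ren ρ t ▷ ren ρ u
  ▷-ren ρ (com t u w) = subst₂ _▷_
    (cong (λ z → es (es _ z) _) (sym (ren-wk ρ u)))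
    (cong₂ (λ y z → es (es y z) _) (ren-comm (λ x → sym (swap-ext ρ x)) t) (sym (ren-wk ρ w)))
    (com (ren (ext (ext ρ)) t) (ren ρ u) (ren ρ w))
  ▷-ren ρ (distR t w u) = subst₂ _▷_ (cong (λ z → es (app z _) _) (sym (ren-wk ρ t))) refl (distR _ _ _)
  ▷-ren ρ (distL t w u) = subst₂ _▷_ (cong (λ z → es (app _ z) _) (sym (ren-wk ρ w))) refl (distL _ _ _)
  ▷-ren ρ (nest t u w)  = subst₂ _▷_ (cong (λ z → es (es z _) _) (sym (ren-up ρ t))) refl (nest _ _ _)

  ≋-ren : ∀ {t u} ρ → t ≋ u → ren ρ t ≋ ren ρ u
  ≋-ren ρ (com t u w)   = ▷⇒≋ (▷-ren ρ (com t u w))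
  ≋-ren ρ (distR t w u) = ▷⇒≋ (▷-ren ρ (distR t w u))
  ≋-ren ρ (distL t w u) = ▷⇒≋ (▷-ren ρ (distL t w u))
  ≋-ren ρ (nest t u w)  = ▷⇒≋ (▷-ren ρ (nest t u w))
  ≋-ren ρ ≋-refl        = ≋-refl
  ≋-ren ρ (≋-sym p)     = ≋-sym (≋-ren ρ p)
  ≋-ren ρ (≋-trans p q) = ≋-trans (≋-ren ρ p) (≋-ren ρ q)
  ≋-ren ρ (appL u p)    = appL _ (≋-ren ρ p)
  ≋-ren ρ (appR t p)    = appR _ (≋-ren ρ p)
  ≋-ren ρ (esL u p)     = esL _ (≋-ren (ext ρ) p)
  ≋-ren ρ (esR t p)     = esR _ (≋-ren ρ p)

  record Simulates (t u : Tm) : Set where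
    field
      step  : ∀ {m γ κ t'} → Step m γ κ t t' → ∃[ u' ] (Step m γ κ u u' × t' ≋ u')
      mult  : ∀ {w r} → UM t w r → ∃[ r' ] (UM u w r' × r ≋ r')
      expo  : ∀ {m γ s r} → UE m γ s t r → ∃[ r' ] (UE m γ s u r' × r ≋ r')
  open Simulates

  UE-app : ∀ {m γ s t u r} → ¬ UE m γ s (app t u) r
  UE-app (here () p s)

  swap-wk-wk : ∀ t → ren swap (wk 1 (wk 1 t)) ≡ wk 1 (wk 1 t)
  swap-wk-wk t = trans (ren-comm {ρ₃ = ext suc} {ρ₄ = λ x → x} swap-wk (wk 1 t))
                       (trans (cong (ren (ext suc)) (ren-id (λ _ → refl) (wk 1 t))) (ren-wk suc t))

  ren-swap-up : ∀ t → ren swap (ren (ext suc) t) ≡ wk 1 t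
  ren-swap-up = ren-ren swap-up

  ren-swap-wk : ∀ t → ren swap (wk 1 t) ≡ ren (ext suc) t
  ren-swap-wk = ren-ren swap-wk

  swap-cycle : ∀ t → ren swap (ren (ext swap) (ren (ext suc) t)) ≡ ren (ext (ext suc)) (ren swap t)
  swap-cycle t = trans (cong (ren swap) (ren-ren {ρ₃ = λ x → ext swap (ext suc x)} (λ _ → refl) t))
                       (ren-comm pointwise t)
    where
    pointwise : ∀ x → swap (ext swap (ext suc x)) ≡ ext (ext suc) (swap x)
    pointwise zero          = refl
    pointwise (suc zero)    = refl
    pointwise (suc (suc x)) = refl

  cycle-swap : ∀ t → ren (ext swap) (ren swap (ren (ext (ext suc)) t)) ≡ ren (ext suc) (ren swap t)
  cycle-swap t = trans (cong (ren (ext swap)) (ren-ren {ρ₃ = λ x → swap (ext (ext suc) x)} (λ _ → refl) t))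
                       (ren-comm pointwise t)
    where
    pointwise : ∀ x → ext swap (swap (ext (ext suc) x)) ≡ ext suc (swap x)
    pointwise zero          = refl
    pointwise (suc zero)    = refl
    pointwise (suc (suc x)) = refl

  UE-cast : ∀ {m γ t t' u u' r} → t ≡ t' → u ≡ u' → UE m γ t u r → UE m γ t' u' r
  UE-cast refl refl p = p

  UM-cast : ∀ {t t' u u' r} → t ≡ t' → u ≡ u' → UM t u r → UM t' u' r
  UM-cast refl refl p = p

  mutual
    com-UE : ∀ {m γ r} u t w → UE m (stat γ w ∙ γ) t (wk 1 u) r →
             ∃[ r' ] (UE m γ (es (ren swap t) (wk 1 w)) u r' × es r w ≋ r')
    com-UE (es u z) t w (esL {r = r} p)
      with com-UE u (ren (ext swap) (ren (ext suc) t)) (wk 1 w)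
             (UE-cast refl (ren-swap-up u)
               (UE-ren (along-swap (stat-wk _ _ z) (sym (stat-wk _ _ w))) p))
    ... | r' , q , e = es r' z
                     , esL (UE-body (cong₂ es (swap-cycle t) (sym (ren-wk suc w))) q)
                     , ≋-trans (com r z w) (esL z e)
    com-UE (cst a) t w (here () p s)
    com-UE (app u z) t w (here () p s)
    com-UE u@(var _) t w (here b p s) = com-UE-here u t w b p s
    com-UE u@(lam _) t w (here b p s) = com-UE-here u t w b p s

    com-UE-here : ∀ {m γ t'} u t w → Bare (wk 1 u) → stat (stat γ w ∙ γ) (wk 1 u) ≡ val →
      Step m (stat (stat γ w ∙ γ) (wk 1 u) ∙ stat γ w ∙ γ) (rep 0 (wk 1 (wk 1 u))) t t' →
      ∃[ r' ] (UE m γ (es (ren swap t) (wk 1 w)) u r' × es (es t' (wk 1 u)) w ≋ r')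
    com-UE-here {t' = t'} u t w b p s =
      _ , here (bare-unren u b) (trans (sym (stat-wk _ _ u)) p)
               (esL (Step-act (cong (rep 1) (swap-wk-wk u))
                              (Step-ren (along-swap (stat-wk _ _ u) (sym (stat-wk _ _ w))) s)))
        , com t' u w

  com-UE⁻ : ∀ {m γ r} w t u → UE m γ (es t (wk 1 u)) w r →
            ∃[ r' ] (UE m (stat γ u ∙ γ) (ren swap t) (wk 1 w) r' × r ≋ es r' u)
  com-UE⁻ w t u (here b p (esL {t' = t'} s)) =
    _ , here (bare-ren suc b) (trans (stat-wk _ _ w) p)
             (Step-act (cong (rep 0) (swap-wk-wk w))
                       (Step-ren (along-swap (stat-wk _ _ u) (sym (stat-wk _ _ w))) s))
      , com t' u w
  com-UE⁻ (es w z) t u (esL p)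
    with com-UE⁻ w (ren (ext (ext suc)) t) (wk 1 u) (UE-body (cong (es _) (ren-wk suc u)) p)
  ... | r' , q , e =
    _ , esL (UE-cast (cycle-swap t) (ren-swap-wk w)
              (UE-ren (along-swap (stat-wk _ _ u) (sym (stat-wk _ _ z))) q))
      , ≋-trans (esL z e) (com r' u z)

  sim-com : ∀ t u w → Simulates (es (es t (wk 1 u)) w) (es (es (ren swap t) (wk 1 w)) u)
  step (sim-com t u w) (ue p) with com-UE⁻ w t u p
  ... | r , q , e = _ , esL (ue q) , e
  step (sim-com t u w) (esL {κ = β _} (ue p)) with com-UE u t w p
  ... | r , q , e = _ , ue q , e
  step (sim-com t u w) {κ = κ} (esL (esL {t' = t'} s)) =
    _ , esL (esL (Step-act (act κ) (Step-ren (along-swap (stat-wk _ _ u) (sym (stat-wk _ _ w))) s)))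
      , com t' u w
    where
    act : ∀ κ → renA swap (renA suc (renA suc κ)) ≡ renA suc (renA suc κ)
    act (β k)     = refl
    act (rep n v) = cong (rep _) (swap-wk-wk v)
  mult (sim-com t u w) {z} (esL (esL {r = r} p)) =
    _ , esL (esL (UM-cast refl (swap-wk-wk z) (UM-ren p))) , com r u w
  expo (sim-com t u w) {s = s} (esL (esL {r = r} p)) =
    _ , esL (esL (UE-body (body s) (UE-ren (along-swap (stat-wk _ _ u) (sym (stat-wk _ _ w))) p)))
      , com r u w
    where
    pointwise : ∀ x → ext swap (ext suc (ext suc x)) ≡ ext suc (ext suc x)
    pointwise zero    = refl
    pointwise (suc x) = refl
    body : ∀ s → ren (ext swap) (ren (ext suc) (ren (ext suc) s)) ≡ ren (ext suc) (ren (ext suc) s)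
    body s = trans (cong (ren (ext swap)) (ren-ren {ρ₃ = λ x → ext suc (ext suc x)} (λ _ → refl) s))
                   (trans (ren-ren pointwise s) (sym (ren-ren (λ _ → refl) s)))

  sim-com⁻ : ∀ t u w → Simulates (es (es (ren swap t) (wk 1 w)) u) (es (es t (wk 1 u)) w)
  sim-com⁻ t u w = subst (λ z → Simulates (es (es (ren swap t) (wk 1 w)) u) (es (es z (wk 1 u)) w))
                         (ren-swap-swap t) (sim-com (ren swap t) w u)

  distR-UM : ∀ {r} t w u → UM (wk 1 t) w r → ∃[ r' ] (UM t (es w u) r' × es r u ≋ r')
  distR-UM (lam b) w u here = _ , here , nest b w u
  distR-UM (es t z) w u (esL {r = r} p)
    with distR-UM t (ren (ext suc) w) (wk 1 u) (UM-cast (ren-swap-up t) (ren-swap-wk w) (UM-ren p))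
  ... | r' , q , e = _ , esL q , ≋-trans (com r z u) (esL z e)

  distR-UM⁻ : ∀ {r} t w u → UM t (es w u) r → ∃[ r' ] (UM (wk 1 t) w r' × r ≋ es r' u)
  distR-UM⁻ (lam b) w u here = _ , here , ≋-sym (nest b w u)
  distR-UM⁻ (es t z) w u (esL p) with distR-UM⁻ t (ren (ext suc) w) (wk 1 u) p
  ... | r' , q , e =
    _ , esL (UM-cast (ren-swap-wk t) (trans (cong (ren swap) (sym (ren-swap-wk w))) (ren-swap-swap (wk 1 w)))
                     (UM-ren q))
      , ≋-trans (esL z e) (com r' u z)

  wk-free : ∀ {m γ v r} t → ¬ Step m γ (rep 0 v) (wk 1 t) r
  wk-free t s with Step-image t s
  ... | _ , ()

  distR-UE : ∀ {m γ r} u t w → UE m γ (app (wk 1 t) w) u r →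
             ∃[ r' ] (UE top γ w u r' × r ≋ app t r')
  distR-UE u t w (here b p (appL f s)) = ⊥-elim (wk-free t s)
  distR-UE u t w (here b p (appR s))   = _ , here b p s , distR t _ u
  distR-UE (es u z) t w (esL p)
    with distR-UE u (wk 1 t) (ren (ext suc) w) (UE-body (cong (λ y → app y _) (ren-wk suc t)) p)
  ... | r' , q , e = _ , esL q , ≋-trans (esL z e) (distR t r' z)

  distR-UE⁻ : ∀ {m γ r} u t w → UE top γ w u r →
              ∃[ r' ] (UE m γ (app (wk 1 t) w) u r' × app t r ≋ r')
  distR-UE⁻ u t w (here b p s) = _ , here b p (appR s) , ≋-sym (distR t _ u)
  distR-UE⁻ (es u z) t w (esL {r = r} p) with distR-UE⁻ u (wk 1 t) (ren (ext suc) w) p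
  ... | r' , q , e = _ , esL (UE-body (cong (λ y → app y _) (sym (ren-wk suc t))) q)
                       , ≋-trans (≋-sym (distR t r z)) (esL z e)

  stat≢-wk : ∀ {γ s} t → stat (s ∙ γ) (wk 1 t) ≢ none → stat γ t ≢ none
  stat≢-wk t f q = f (trans (stat-wk _ _ t) q)

  wk-stat≢ : ∀ {γ s} t → stat γ t ≢ none → stat (s ∙ γ) (wk 1 t) ≢ none
  wk-stat≢ t f q = f (trans (sym (stat-wk _ _ t)) q)

  Step-unwk : ∀ {m γ s r} κ t → Step m (s ∙ γ) (renA suc κ) (wk 1 t) r →
              ∃[ r₀ ] (Step m γ κ t r₀ × r ≡ wk 1 r₀)
  Step-unwk κ t = Step-unren κ t suc-injective (λ _ → refl)

  Step-wk : ∀ {m γ s κ t r} → Step m γ κ t r → Step m (s ∙ γ) (renA suc κ) (wk 1 t) (wk 1 r)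
  Step-wk = Step-ren (λ _ → refl)

  sim-distR : ∀ t w u → Simulates (es (app (wk 1 t) w) u) (app t (es w u))
  step (sim-distR t w u) (ue p) with distR-UE u t w p
  ... | r , q , e = _ , appR (ue q) , e
  step (sim-distR t w u) (esL {κ = β _} (um f p)) with distR-UM t w u p
  ... | r , q , e = _ , um f q , e
  step (sim-distR t w u) {κ = κ} (esL (appL f s)) with Step-unwk κ t s
  ... | r , s' , refl = _ , appL f s' , distR r w u
  step (sim-distR t w u) (esL (appR {u' = w'} s)) = _ , appR (esL s) , distR t w' u
  mult (sim-distR t w u) (esL ())
  expo (sim-distR t w u) (esL p) = ⊥-elim (UE-app p)

  sim-distR⁻ : ∀ t w u → Simulates (app t (es w u)) (es (app (wk 1 t) w) u)
  step (sim-distR⁻ t w u) (um f p) with distR-UM⁻ t w u p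
  ... | r , q , e = _ , esL (um f q) , e
  step (sim-distR⁻ t w u) (appL {t' = t'} f s) = _ , esL (appL f (Step-wk s)) , ≋-sym (distR t' w u)
  step (sim-distR⁻ t w u) (appR (ue p)) with distR-UE⁻ u t w p
  ... | r , q , e = _ , ue q , e
  step (sim-distR⁻ t w u) (appR (esL {t' = w'} s)) = _ , esL (appR s) , ≋-sym (distR t w' u)
  mult (sim-distR⁻ t w u) ()
  expo (sim-distR⁻ t w u) p = ⊥-elim (UE-app p)

  distL-UE : ∀ {m γ r} u t w → UE m γ (app t (wk 1 w)) u r →
             stat γ w ≢ none × ∃[ r' ] (UE hd γ t u r' × r ≋ app r' w)
  distL-UE u t w (here b p (appL f s)) = stat≢-wk w f , _ , here b p s , distL _ w u
  distL-UE u t w (here b p (appR s))   = ⊥-elim (wk-free w s)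
  distL-UE (es u z) t w (esL p)
    with distL-UE u (ren (ext suc) t) (wk 1 w) (UE-body (cong (app _) (ren-wk suc w)) p)
  ... | f , r' , q , e = stat≢-wk w f , _ , esL q , ≋-trans (esL z e) (distL r' w z)

  distL-UE⁻ : ∀ {m γ r} u t w → stat γ w ≢ none → UE hd γ t u r →
              ∃[ r' ] (UE m γ (app t (wk 1 w)) u r' × app r w ≋ r')
  distL-UE⁻ u t w f (here b p s) = _ , here b p (appL (wk-stat≢ w f) s) , ≋-sym (distL _ w u)
  distL-UE⁻ (es u z) t w f (esL {r = r} p)
    with distL-UE⁻ u (ren (ext suc) t) (wk 1 w) (wk-stat≢ w f) p
  ... | r' , q , e = _ , esL (UE-body (cong (app _) (sym (ren-wk suc w))) q)
                       , ≋-trans (≋-sym (distL r w z)) (esL z e)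

  sim-distL : ∀ t w u → Simulates (es (app t (wk 1 w)) u) (app (es t u) w)
  step (sim-distL t w u) (ue p) with distL-UE u t w p
  ... | f , r , q , e = _ , appL f (ue q) , e
  step (sim-distL t w u) (esL {κ = β _} (um f p)) = _ , um (stat≢-wk w f) (esL p) , ≋-refl
  step (sim-distL t w u) (esL (appL {t' = t'} f s)) = _ , appL (stat≢-wk w f) (esL s) , distL t' w u
  step (sim-distL t w u) {κ = κ} (esL (appR s)) with Step-unwk κ w s
  ... | w' , s' , refl = _ , appR s' , distL t w' u
  mult (sim-distL t w u) (esL ())
  expo (sim-distL t w u) (esL p) = ⊥-elim (UE-app p)

  sim-distL⁻ : ∀ t w u → Simulates (app (es t u) w) (es (app t (wk 1 w)) u)
  step (sim-distL⁻ t w u) (um f (esL p)) = _ , esL (um (wk-stat≢ w f) p) , ≋-refl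
  step (sim-distL⁻ t w u) (appL f (ue p)) with distL-UE⁻ u t w f p
  ... | r , q , e = _ , ue q , e
  step (sim-distL⁻ t w u) (appL f (esL {t' = t'} s)) =
    _ , esL (appL (wk-stat≢ w f) s) , ≋-sym (distL t' w u)
  step (sim-distL⁻ t w u) (appR {u' = w'} s) = _ , esL (appR (Step-wk s)) , ≋-sym (distL t w' u)
  mult (sim-distL⁻ t w u) ()
  expo (sim-distL⁻ t w u) p = ⊥-elim (UE-app p)

  up-action : ∀ κ → renA (ext suc) (renA suc κ) ≡ renA suc (renA suc κ)
  up-action = renA-comm (λ _ → refl)

  sim-nest : ∀ t u w → Simulates (es (es (ren (ext suc) t) u) w) (es t (es u w))
  step (sim-nest t u w) (ue p) with UE-step _ (var 0) p
  ... | _ , esL s with Step-image t s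
  ... | zero , ()
  ... | suc _ , ()
  step (sim-nest t u w) (esL {κ = β _} (ue p)) = _ , ue (esL p) , ≋-refl
  step (sim-nest t u w) {κ = κ} (esL (esL s))
    with Step-unren (renA suc κ) t ext-suc-inj (along-up refl) (Step-act (sym (up-action κ)) s)
  ... | t' , s' , refl = _ , esL s' , nest t' u w
  mult (sim-nest t u w) {z} (esL (esL p)) with UM-reflect t (wk 1 z) p refl (sym (ren-wk suc z))
  ... | r , q , refl = _ , esL q , nest r u w
  expo (sim-nest t u w) {s = s} (esL (esL p))
    with UE-reflect (ren (ext suc) s) t (along-up refl) p (sym (ren-up suc s)) refl
  ... | r , q , refl = _ , esL q , nest r u w

  sim-nest⁻ : ∀ t u w → Simulates (es t (es u w)) (es (es (ren (ext suc) t) u) w)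
  step (sim-nest⁻ t u w) (ue (esL p)) = _ , esL (ue p) , ≋-refl
  step (sim-nest⁻ t u w) {κ = κ} (esL {t' = t'} s) =
    _ , esL (esL (Step-act (up-action κ) (Step-ren (along-up refl) s))) , ≋-sym (nest t' u w)
  mult (sim-nest⁻ t u w) {z} (esL {r = r} p) =
    _ , esL (esL (UM-cast refl (ren-wk suc z) (UM-ren p))) , ≋-sym (nest r u w)
  expo (sim-nest⁻ t u w) {s = s} (esL {r = r} p) =
    _ , esL (esL (UE-body (ren-up suc s) (UE-ren (along-up refl) p))) , ≋-sym (nest r u w)

  sim-▷ : ∀ {t u} → t ▷ u → Simulates t u × Simulates u t
  sim-▷ (com t u w)   = sim-com t u w , sim-com⁻ t u w
  sim-▷ (distR t w u) = sim-distR t w u , sim-distR⁻ t w u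
  sim-▷ (distL t w u) = sim-distL t w u , sim-distL⁻ t w u
  sim-▷ (nest t u w)  = sim-nest t u w , sim-nest⁻ t u w

  StablySimulates : Tm → Tm → Set
  StablySimulates t u = ∀ ρ → Simulates (ren ρ t) (ren ρ u)

  stable-ren : ∀ {t u} ρ → StablySimulates t u → StablySimulates (ren ρ t) (ren ρ u)
  stable-ren {t} {u} ρ h ρ' =
    subst₂ Simulates (sym (ren-ren (λ _ → refl) t)) (sym (ren-ren (λ _ → refl) u)) (h (λ x → ρ' (ρ x)))

  stable-id : ∀ {t u} → StablySimulates t u → Simulates t u
  stable-id {t} {u} h = subst₂ Simulates (ren-id (λ _ → refl) t) (ren-id (λ _ → refl) u) (h (λ x → x))

  UE-sim : ∀ {t t'} → StablySimulates t t' → ∀ {m γ u r} → UE m γ t u r →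
           ∃[ r' ] (UE m γ t' u r' × r ≋ r')
  UE-sim h (here b p s) with step (stable-id h) s
  ... | _ , s' , q = _ , here b p s' , esL _ q
  UE-sim h (esL p) with UE-sim (stable-ren (ext suc) h) p
  ... | _ , q , e' = _ , esL q , esL _ e'

  UM-arg : ∀ {t u u' r} → u ≋ u' → UM t u r → ∃[ r' ] (UM t u' r' × r ≋ r')
  UM-arg e here = _ , here , esR _ e
  UM-arg e (esL p) with UM-arg (≋-ren suc e) p
  ... | _ , q , e' = _ , esL q , esL _ e'

  stat≢-≋ : ∀ {u u' γ} → u ≋ u' → stat γ u ≢ none → stat γ u' ≢ none
  stat≢-≋ e f q = f (trans (stat-≋ e _) q)

  sim-appL : ∀ {t t'} u → t ≋ t' → Simulates t t' → Simulates (app t u) (app t' u)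
  step (sim-appL u e h) (um f p) with mult h p
  ... | _ , q , e' = _ , um f q , e'
  step (sim-appL u e h) (appL f s) with step h s
  ... | _ , s' , e' = _ , appL f s' , appL u e'
  step (sim-appL u e h) (appR s) = _ , appR s , appL _ e
  mult (sim-appL u e h) ()
  expo (sim-appL u e h) p = ⊥-elim (UE-app p)

  sim-appR : ∀ {u u'} t → u ≋ u' → Simulates u u' → Simulates (app t u) (app t u')
  step (sim-appR t e h) (um f p) with UM-arg e p
  ... | _ , q , e' = _ , um (stat≢-≋ e f) q , e'
  step (sim-appR t e h) (appL f s) = _ , appL (stat≢-≋ e f) s , appR _ e
  step (sim-appR t e h) (appR s) with step h s
  ... | _ , s' , e' = _ , appR s' , appR t e'
  mult (sim-appR t e h) ()
  expo (sim-appR t e h) p = ⊥-elim (UE-app p)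

  sim-esL : ∀ {t t'} u → StablySimulates t t' → Simulates (es t u) (es t' u)
  step (sim-esL u h) (ue p) with UE-sim h p
  ... | _ , q , e' = _ , ue q , e'
  step (sim-esL u h) (esL s) with step (stable-id h) s
  ... | _ , s' , e' = _ , esL s' , esL u e'
  mult (sim-esL u h) (esL p) with mult (stable-id h) p
  ... | _ , q , e' = _ , esL q , esL u e'
  expo (sim-esL u h) (esL p) with expo (stable-id h) p
  ... | _ , q , e' = _ , esL q , esL u e'

  sim-esR : ∀ {u u'} t → u ≋ u' → Simulates u u' → Simulates (es t u) (es t u')
  step (sim-esR t e h) (ue p) with expo h p
  ... | _ , q , e' = _ , ue q , e'
  step (sim-esR t e h) {m} {γ} {κ} (esL s) =
    _ , esL (subst (λ z → Step m (z ∙ γ) (renA suc κ) t _) (stat-≋ e γ) s) , esR _ e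
  mult (sim-esR t e h) (esL p) = _ , esL p , esR _ e
  expo (sim-esR t e h) {m} {γ} {s} (esL p) =
    _ , esL (subst (λ z → UE m (z ∙ γ) (ren (ext suc) s) t _) (stat-≋ e γ) p) , esR _ e

  sim-refl : ∀ {t} → Simulates t t
  step sim-refl s = _ , s , ≋-refl
  mult sim-refl p = _ , p , ≋-refl
  expo sim-refl p = _ , p , ≋-refl

  sim-trans : ∀ {t u w} → Simulates t u → Simulates u w → Simulates t w
  step (sim-trans h k) s with step h s
  ... | _ , s' , e with step k s'
  ... | _ , s'' , e' = _ , s'' , ≋-trans e e'
  mult (sim-trans h k) s with mult h s
  ... | _ , s' , e with mult k s'
  ... | _ , s'' , e' = _ , s'' , ≋-trans e e'
  expo (sim-trans h k) s with expo h s
  ... | _ , s' , e with expo k s'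
  ... | _ , s'' , e' = _ , s'' , ≋-trans e e'

  bisim-▷ : ∀ {t u} → t ▷ u → StablySimulates t u × StablySimulates u t
  bisim-▷ a = (λ ρ → proj₁ (sim-▷ (▷-ren ρ a))) , (λ ρ → proj₂ (sim-▷ (▷-ren ρ a)))

  bisim : ∀ {t u} → t ≋ u → StablySimulates t u × StablySimulates u t
  bisim (com t u w)   = bisim-▷ (com t u w)
  bisim (distR t w u) = bisim-▷ (distR t w u)
  bisim (distL t w u) = bisim-▷ (distL t w u)
  bisim (nest t u w)  = bisim-▷ (nest t u w)
  bisim ≋-refl        = (λ ρ → sim-refl) , (λ ρ → sim-refl)
  bisim (≋-sym p)     = let (h , k) = bisim p in k , h
  bisim (≋-trans p q) = let (h , k) = bisim p ; (h' , k') = bisim q in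
    (λ ρ → sim-trans (h ρ) (h' ρ)) , (λ ρ → sim-trans (k' ρ) (k ρ))
  bisim (appL u p) = let (h , k) = bisim p in
    (λ ρ → sim-appL _ (≋-ren ρ p) (h ρ)) , (λ ρ → sim-appL _ (≋-ren ρ (≋-sym p)) (k ρ))
  bisim (appR t p) = let (h , k) = bisim p in
    (λ ρ → sim-appR _ (≋-ren ρ p) (h ρ)) , (λ ρ → sim-appR _ (≋-ren ρ (≋-sym p)) (k ρ))
  bisim (esL u p) = let (h , k) = bisim p in
    (λ ρ → sim-esL _ (stable-ren (ext ρ) h)) ,
    (λ ρ → sim-esL _ (stable-ren (ext ρ) k))
  bisim (esR t p) = let (h , k) = bisim p in
    (λ ρ → sim-esR _ (≋-ren ρ p) (h ρ)) , (λ ρ → sim-esR _ (≋-ren ρ (≋-sym p)) (k ρ))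

  -- Good terms

  isλ-ren : ∀ {t} ρ → IsλTerm t → IsλTerm (ren ρ t)
  isλ-ren ρ (var x)   = var _
  isλ-ren ρ (cst a)   = cst a
  isλ-ren ρ (lam p)   = lam (isλ-ren (ext ρ) p)
  isλ-ren ρ (app p q) = app (isλ-ren ρ p) (isλ-ren ρ q)

  isλ-unren : ∀ {ρ} t → IsλTerm (ren ρ t) → IsλTerm t
  isλ-unren (var x) p           = var x
  isλ-unren (cst a) p           = cst a
  isλ-unren (lam t) (lam p)     = lam (isλ-unren t p)
  isλ-unren (app t u) (app p q) = app (isλ-unren t p) (isλ-unren u q)

  -- The invariant of evaluation that makes ≋ a bisimulation: every substituted term is a
  -- fireball in its environment, and there are no explicit substitutions under λ.
  Good : (ℕ → Status) → Tm → Set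
  Good γ (var x)   = ⊤
  Good γ (cst a)   = ⊤
  Good γ (lam t)   = IsλTerm t
  Good γ (app t u) = Good γ t × Good γ u
  Good γ (es t u)  = Good γ u × stat γ u ≢ none × Good (stat γ u ∙ γ) t

  isλ-good : ∀ {γ t} → IsλTerm t → Good γ t
  isλ-good (var x)   = tt
  isλ-good (cst a)   = tt
  isλ-good (lam p)   = p
  isλ-good (app p q) = isλ-good p , isλ-good q

  good-ren : ∀ {ρ γ γ'} → Along ρ γ γ' → ∀ t → Good γ t → Good γ' (ren ρ t)
  good-ren e (var x) g         = tt
  good-ren e (cst a) g         = tt
  good-ren e (lam t) g         = isλ-ren _ g
  good-ren e (app t u) (g , h) = good-ren e t g , good-ren e u h
  good-ren e (es t u) (g , f , h) =
    good-ren e u g , (λ q → f (trans (stat-ren e u) q)) , good-ren (along-ext (stat-ren e u) e) t h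

  good-unren : ∀ {ρ γ γ'} → Along ρ γ γ' → ∀ t → Good γ' (ren ρ t) → Good γ t
  good-unren e (var x) g         = tt
  good-unren e (cst a) g         = tt
  good-unren e (lam t) g         = isλ-unren t g
  good-unren e (app t u) (g , h) = good-unren e t g , good-unren e u h
  good-unren e (es t u) (g , f , h) =
    good-unren e u g , (λ q → f (trans (sym (stat-ren e u)) q)) , good-unren (along-ext (stat-ren e u) e) t h

  good-wk : ∀ {γ s} t → Good γ t → Good (s ∙ γ) (wk 1 t)
  good-wk = good-ren (λ _ → refl)

  good-unwk : ∀ {γ s} t → Good (s ∙ γ) (wk 1 t) → Good γ t
  good-unwk = good-unren (λ _ → refl)

  mutual
    good-≋ : ∀ {t u} → t ≋ u → ∀ {γ} → Good γ t → Good γ u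
    good-≋ (com t u w) (gw , fw , gu , fu , gt) =
      good-unwk u gu , stat≢-wk u fu , good-wk w gw , wk-stat≢ w fw ,
      good-ren (along-swap (stat-wk _ _ u) (sym (stat-wk _ _ w))) t gt
    good-≋ (distR t w u) (gu , fu , gt , gw) = good-unwk t gt , gu , fu , gw
    good-≋ (distL t w u) (gu , fu , gt , gw) = (gu , fu , gt) , good-unwk w gw
    good-≋ (nest t u w) (gw , fw , gu , fu , gt) =
      (gw , fw , gu) , fu , good-unren (along-up refl) t gt
    good-≋ ≋-refl g = g
    good-≋ (≋-sym p) g = good-≋⁻ p g
    good-≋ (≋-trans p q) g = good-≋ q (good-≋ p g)
    good-≋ (appL u p) (g , h) = good-≋ p g , h
    good-≋ (appR t p) (g , h) = g , good-≋ p h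
    good-≋ (esL u p) (g , f , h) = g , f , good-≋ p h
    good-≋ (esR t p) {γ} (g , f , h) =
      good-≋ p g , stat≢-≋ p f , subst (λ s → Good (s ∙ γ) t) (stat-≋ p γ) h

    good-≋⁻ : ∀ {t u} → t ≋ u → ∀ {γ} → Good γ u → Good γ t
    good-≋⁻ (com t u w) (gu , fu , gw , fw , gt) =
      good-unwk w gw , stat≢-wk w fw , good-wk u gu , wk-stat≢ u fu ,
      good-unren (along-swap (stat-wk _ _ u) (sym (stat-wk _ _ w))) t gt
    good-≋⁻ (distR t w u) (gt , gu , fu , gw) = gu , fu , good-wk t gt , gw
    good-≋⁻ (distL t w u) ((gu , fu , gt) , gw) = gu , fu , gt , good-wk w gw
    good-≋⁻ (nest t u w) ((gw , fw , gu) , fu , gt) =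
      gw , fw , gu , fu , good-ren (along-up refl) t gt
    good-≋⁻ ≋-refl g = g
    good-≋⁻ (≋-sym p) g = good-≋ p g
    good-≋⁻ (≋-trans p q) g = good-≋⁻ p (good-≋⁻ q g)
    good-≋⁻ (appL u p) (g , h) = good-≋⁻ p g , h
    good-≋⁻ (appR t p) (g , h) = g , good-≋⁻ p h
    good-≋⁻ (esL u p) (g , f , h) = g , f , good-≋⁻ p h
    good-≋⁻ (esR t p) {γ} (g , f , h) =
      good-≋⁻ p g , stat≢-≋ (≋-sym p) f , subst (λ s → Good (s ∙ γ) t) (sym (stat-≋ p γ)) h

  GoodAct : (ℕ → Status) → Act → Set
  GoodAct γ (β k)     = ⊤
  GoodAct γ (rep n v) = Good γ v

  goodAct-suc : ∀ {γ s} κ → GoodAct γ κ → GoodAct (s ∙ γ) (renA suc κ)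
  goodAct-suc (β k)     g = tt
  goodAct-suc (rep n v) g = good-wk v g

  good-UM : ∀ {γ t u r} → UM t u r → stat γ u ≢ none → Good γ t → Good γ u → Good γ r
  good-UM here f g h = h , f , isλ-good g
  good-UM (esL {u = u} p) f (gw , fw , g) h = gw , fw , good-UM p (wk-stat≢ u f) g (good-wk u h)

  val≢none : val ≢ none
  val≢none ()

  mutual
    good-Step : ∀ {m γ κ t t'} → GoodAct γ κ → Step m γ κ t t' → Good γ t → Good γ t'
    good-Step a here g = a
    good-Step a (um f p) (g , h) = good-UM p f g h
    good-Step a (ue p) (g , f , h) = good-UE p h g
    good-Step a (appL f s) (g , h) = good-Step a s g , h
    good-Step a (appR s) (g , h) = g , good-Step a s h
    good-Step {κ = κ} a (esL s) (g , f , h) = g , f , good-Step (goodAct-suc κ a) s h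

    good-UE : ∀ {m γ t u r} → UE m γ t u r → Good (stat γ u ∙ γ) t → Good γ u → Good γ r
    good-UE (here {v = v} b p s) g h =
      h , (λ q → val≢none (trans (sym p) q)) , good-Step (good-wk v h) s g
    good-UE (esL {t = t} p) g (gw , fw , gu) = gw , fw , good-UE p (good-ren (along-up refl) t g) gu

  -- Statuses and unfoldings

  ∅ : ℕ → Status
  ∅ _ = none

  isλ-sub : ∀ {t σ} → (∀ x → IsλTerm (σ x)) → IsλTerm t → IsλTerm (sub σ t)
  isλ-sub h (var x)   = h x
  isλ-sub h (cst a)   = cst a
  isλ-sub {σ = σ} h (lam p) = lam (isλ-sub h' p)
    where
    h' : ∀ x → IsλTerm (exts σ x)
    h' zero    = var 0
    h' (suc x) = isλ-ren suc (h x)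
  isλ-sub h (app p q) = app (isλ-sub h p) (isλ-sub h q)

  isλ-[0:=] : ∀ {u} → IsλTerm u → ∀ x → IsλTerm ([0:= u ] x)
  isλ-[0:=] p zero    = p
  isλ-[0:=] p (suc x) = var x

  isλ-↓ : ∀ t → IsλTerm (t ↓)
  isλ-↓ (var x)   = var x
  isλ-↓ (cst a)   = cst a
  isλ-↓ (lam t)   = lam (isλ-↓ t)
  isλ-↓ (app t u) = app (isλ-↓ t) (isλ-↓ u)
  isλ-↓ (es t u)  = isλ-sub (isλ-[0:=] (isλ-↓ u)) (isλ-↓ t)

  isλ-↓[] : ∀ t S → IsλTerm (t ↓[ S ])
  isλ-↓[] t □          = isλ-↓ t
  isλ-↓[] t (appL S u) = isλ-↓[] t S
  isλ-↓[] t (appR u S) = isλ-↓[] t S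
  isλ-↓[] t (esL S u)  = isλ-sub (isλ-[0:=] (isλ-↓ u)) (isλ-↓[] t S)

  Composed : (ℕ → Tm) → (ℕ → Status) → (ℕ → Status) → Set
  Composed σ γ γ' = ∀ x → stat γ (σ x) ≡ γ' x

  composed-exts : ∀ {σ γ γ' s s'} → s ≡ s' → Composed σ γ γ' → Composed (exts σ) (s ∙ γ) (s' ∙ γ')
  composed-exts p e zero    = p
  composed-exts {σ} p e (suc x) = trans (stat-wk _ _ (σ x)) (e x)

  stat-sub : ∀ {σ γ γ'} → Composed σ γ γ' → ∀ t → stat γ (sub σ t) ≡ stat γ' t
  stat-sub e (var x)   = e x
  stat-sub e (cst a)   = refl
  stat-sub e (lam t)   = refl
  stat-sub e (app t u) = cong₂ appS (stat-sub e t) (stat-sub e u)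
  stat-sub e (es t u)  = stat-sub (composed-exts (stat-sub e u) e) t

  composed-[0:=] : ∀ {u γ s} → stat γ u ≡ s → Composed [0:= u ] γ (s ∙ γ)
  composed-[0:=] p zero    = p
  composed-[0:=] p (suc x) = refl

  stat-↓ : ∀ γ t → stat γ (t ↓) ≡ stat γ t
  stat-↓ γ (var x)   = refl
  stat-↓ γ (cst a)   = refl
  stat-↓ γ (lam t)   = refl
  stat-↓ γ (app t u) = cong₂ appS (stat-↓ γ t) (stat-↓ γ u)
  stat-↓ γ (es t u)  = trans (stat-sub (composed-[0:=] (stat-↓ γ u)) (t ↓)) (stat-↓ _ t)

  within : (ℕ → Status) → ShCtx → ℕ → Status
  within γ □          = γ
  within γ (appL S u) = within γ S
  within γ (appR u S) = within γ S
  within γ (esL S u)  = within (stat γ u ∙ γ) S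

  stat-↓[] : ∀ γ t S → stat γ (t ↓[ S ]) ≡ stat (within γ S) t
  stat-↓[] γ t □          = stat-↓ γ t
  stat-↓[] γ t (appL S u) = stat-↓[] γ t S
  stat-↓[] γ t (appR u S) = stat-↓[] γ t S
  stat-↓[] γ t (esL S u)  = trans (stat-sub (composed-[0:=] (stat-↓ γ u)) (t ↓[ S ])) (stat-↓[] _ t S)

  inert≢none : inert ≢ none
  inert≢none ()

  mutual
    fireball-stat : ∀ {γ t} → Fireball t → stat γ t ≢ none
    fireball-stat (value (lam t)) q = val≢none q
    fireball-stat (inert p) q = inert≢none (trans (sym (inert-stat p)) q)

    inert-stat : ∀ {γ t} → Inert t → stat γ t ≡ inert
    inert-stat (cst a) = refl
    inert-stat {γ} (app {u = u} p f) rewrite inert-stat {γ} p = appS-inert (stat γ u) (fireball-stat f)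

  value-stat : ∀ {γ t} → Value t → stat γ t ≡ val
  value-stat (lam t) = refl

  appS-inert⁻ : ∀ s s' → appS s s' ≢ none → s ≡ inert × s' ≢ none
  appS-inert⁻ none  s'    p = ⊥-elim (p refl)
  appS-inert⁻ val   s'    p = ⊥-elim (p refl)
  appS-inert⁻ inert s'    p = refl , λ { refl → p refl }

  stat-value : ∀ {t} → IsλTerm t → stat ∅ t ≡ val → Value t
  stat-value (lam {t} p) q = lam t
  stat-value (app p p') q = ⊥-elim (appS≢val _ _ q)

  mutual
    stat-inert : ∀ {t} → IsλTerm t → stat ∅ t ≡ inert → Inert t
    stat-inert (cst a) q = cst a
    stat-inert (app {t} {u} p p') q
      with appS-inert⁻ (stat ∅ t) (stat ∅ u) (λ z → inert≢none (trans (sym q) z))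
    ... | q₁ , q₂ = app (stat-inert p q₁) (stat-fireball p' q₂)

    stat-fireball : ∀ {t} → IsλTerm t → stat ∅ t ≢ none → Fireball t
    stat-fireball (var x) q = ⊥-elim (q refl)
    stat-fireball (cst a) q = inert (cst a)
    stat-fireball (lam p) q = value (lam _)
    stat-fireball (app {t} {u} p p') q with appS-inert⁻ (stat ∅ t) (stat ∅ u) q
    ... | q₁ , q₂ = inert (app (stat-inert p q₁) (stat-fireball p' q₂))

  -- Evaluable contexts

  Ev : (ℕ → Status) → ShCtx → Set
  Ev γ □          = ⊤
  Ev γ (appL S t) = (stat γ t ≢ none) × Ev γ S
  Ev γ (appR t S) = Ev γ S
  Ev γ (esL S t)  = (stat γ t ≢ none) × Ev (stat γ t ∙ γ) S

  ev-sub : ∀ {σ γ γ'} → Composed σ γ γ' → ∀ S → Ev γ (subCtx σ S) ≡ Ev γ' S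
  ev-sub e □          = refl
  ev-sub e (appL S t) = cong₂ (λ s P → (s ≢ none) × P) (stat-sub e t) (ev-sub e S)
  ev-sub e (appR t S) = ev-sub e S
  ev-sub e (esL S t)  =
    cong₂ (λ s P → (s ≢ none) × P) (stat-sub e t) (ev-sub (composed-exts (stat-sub e t) e) S)

  evaluable-ev : ∀ {S} → Evaluable S → Ev ∅ S
  evaluable-ev □ = tt
  evaluable-ev (appL {t = t} p f) = (λ q → fireball-stat f (trans (stat-↓ ∅ t) q)) , evaluable-ev p
  evaluable-ev (appR p) = evaluable-ev p
  evaluable-ev (esL {S} {t} f p) =
    (λ q → fireball-stat f (trans (stat-↓ ∅ t) q)) ,
    subst (λ P → P) (ev-sub (composed-[0:=] (stat-↓ ∅ t)) S) (evaluable-ev p)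

  size : ShCtx → ℕ
  size □          = 0
  size (appL S t) = suc (size S)
  size (appR t S) = suc (size S)
  size (esL S t)  = suc (size S)

  size-sub : ∀ σ S → size (subCtx σ S) ≡ size S
  size-sub σ □          = refl
  size-sub σ (appL S t) = cong suc (size-sub σ S)
  size-sub σ (appR t S) = cong suc (size-sub σ S)
  size-sub σ (esL S t)  = cong suc (size-sub (exts σ) S)

  fireball-↓ : ∀ t → stat ∅ t ≢ none → Fireball (t ↓)
  fireball-↓ t f = stat-fireball (isλ-↓ t) (λ q → f (trans (sym (stat-↓ ∅ t)) q))

  ev-evaluable : ∀ n S → size S ≡ n → Ev ∅ S → Evaluable S
  ev-evaluable n □ e p = □
  ev-evaluable (suc n) (appL S t) e (f , p) = appL (ev-evaluable n S (suc-injective e) p) (fireball-↓ t f)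
  ev-evaluable (suc n) (appR t S) e p = appR (ev-evaluable n S (suc-injective e) p)
  ev-evaluable (suc n) (esL S t) e (f , p) =
    esL (fireball-↓ t f)
        (ev-evaluable n (subCtx [0:= t ↓ ] S) (trans (size-sub _ S) (suc-injective e))
          (subst (λ P → P) (sym (ev-sub (composed-[0:=] (stat-↓ ∅ t)) S)) p))

  ev-∘ : ∀ {γ} S {S'} → Ev γ S → Ev (within γ S) S' → Ev γ (S ∘ S')
  ev-∘ □ p q                = q
  ev-∘ (appL S u) (f , p) q = f , ev-∘ S p q
  ev-∘ (appR u S) p q       = ev-∘ S p q
  ev-∘ (esL S u) (f , p) q  = f , ev-∘ S p q

  ev-∘⁻ : ∀ {γ} S {S'} → Ev γ (S ∘ S') → Ev γ S × Ev (within γ S) S'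
  ev-∘⁻ □ q                = tt , q
  ev-∘⁻ (appL S u) (f , p) = let (q , r) = ev-∘⁻ S p in (f , q) , r
  ev-∘⁻ (appR u S) p       = ev-∘⁻ S p
  ev-∘⁻ (esL S u) (f , p)  = let (q , r) = ev-∘⁻ S p in (f , q) , r

  within-∘ : ∀ γ S S' → within γ (S ∘ S') ≡ within (within γ S) S'
  within-∘ γ □ S'          = refl
  within-∘ γ (appL S u) S' = within-∘ γ S S'
  within-∘ γ (appR u S) S' = within-∘ γ S S'
  within-∘ γ (esL S u) S'  = within-∘ _ S S'

  inner : Mode → ShCtx → Mode
  inner m □          = m
  inner m (appL S u) = inner hd S
  inner m (appR u S) = inner top S
  inner m (esL S u)  = inner m S

  inner-∘ : ∀ m S S' → inner m (S ∘ S') ≡ inner (inner m S) S'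
  inner-∘ m □ S'          = refl
  inner-∘ m (appL S u) S' = inner-∘ hd S S'
  inner-∘ m (appR u S) S' = inner-∘ top S S'
  inner-∘ m (esL S u) S'  = inner-∘ m S S'

  inner-⌈⌉ : ∀ m L → inner m ⌈ L ⌉ ≡ m
  inner-⌈⌉ m □         = refl
  inner-⌈⌉ m (esL L u) = inner-⌈⌉ m L

  applicative-inner : ∀ S m → Applicative S → inner m S ≡ hd
  applicative-inner S m (S' , L , u , refl) = trans (inner-∘ m S' _) (inner-⌈⌉ hd L)

  inner-applicative : ∀ S m → inner m S ≡ hd → Applicative S ⊎ (m ≡ hd × ∃[ L ] S ≡ ⌈ L ⌉)
  inner-applicative □ m p = inj₂ (p , □ , refl)
  inner-applicative (appL S u) m p with inner-applicative S hd p
  ... | inj₁ (S' , L , w , refl) = inj₁ (appL S' u , L , w , refl)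
  ... | inj₂ (_ , L , refl)      = inj₁ (□ , L , u , refl)
  inner-applicative (appR u S) m p with inner-applicative S top p
  ... | inj₁ (S' , L , w , refl) = inj₁ (appR u S' , L , w , refl)
  inner-applicative (esL S u) m p with inner-applicative S m p
  ... | inj₁ (S' , L , w , refl) = inj₁ (esL S' u , L , w , refl)
  ... | inj₂ (q , L , refl)      = inj₂ (q , esL L u , refl)

  top-applicative : ∀ S → inner top S ≡ hd → Applicative S
  top-applicative S p with inner-applicative S top p
  ... | inj₁ a = a

  -- The two presentations of the strategy agree

  renA-ren : ∀ {ρ₁ ρ₂ ρ₃} → (∀ x → ρ₁ (ρ₂ x) ≡ ρ₃ x) → ∀ κ → renA ρ₁ (renA ρ₂ κ) ≡ renA ρ₃ κ
  renA-ren e (β k)     = refl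
  renA-ren e (rep n v) = cong₂ rep (e n) (ren-ren e v)

  Step-plug : ∀ {m γ κ t t'} S → Ev γ S →
    Step (inner m S) (within γ S) (renA (depth S +_) κ) t t' → Step m γ κ (S ⟨ t ⟩) (S ⟨ t' ⟩)
  Step-plug {κ = κ} □ e s          = Step-act (renA-id (λ _ → refl) κ) s
  Step-plug (appL S u) (f , e) s   = appL f (Step-plug S e s)
  Step-plug (appR u S) e s         = appR (Step-plug S e s)
  Step-plug {κ = κ} (esL S u) (f , e) s =
    esL (Step-plug S e (Step-act (sym (renA-ren (+-suc (depth S)) κ)) s))

  wk-wk : ∀ d u → wk d (wk 1 u) ≡ wk (suc d) u
  wk-wk d = ren-ren (+-suc d)

  UM-plug : ∀ L b u → UM (⌈ L ⌉ ⟨ lam b ⟩) u (⌈ L ⌉ ⟨ es b (wk (depth ⌈ L ⌉) u) ⟩)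
  UM-plug □ b u = subst (λ z → UM (lam b) u (es b z)) (sym (ren-id (λ _ → refl) u)) here
  UM-plug (esL L w) b u =
    esL (subst (λ z → UM (⌈ L ⌉ ⟨ lam b ⟩) (wk 1 u) (⌈ L ⌉ ⟨ es b z ⟩)) (wk-wk (depth ⌈ L ⌉) u)
               (UM-plug L b (wk 1 u)))

  UM-split : ∀ {t u r} → UM t u r →
    ∃[ L ] ∃[ b ] (t ≡ ⌈ L ⌉ ⟨ lam b ⟩ × r ≡ ⌈ L ⌉ ⟨ es b (wk (depth ⌈ L ⌉) u) ⟩)
  UM-split {u = u} here = □ , _ , refl , cong (es _) (sym (ren-id (λ _ → refl) u))
  UM-split {u = u} (esL {w = w} {u = u'} p) with UM-split p
  ... | L , b , refl , refl =
    esL L w , b , refl , cong (λ z → es (⌈ L ⌉ ⟨ es b z ⟩) w) (wk-wk (depth ⌈ L ⌉) u)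

  ren-plug-var : ∀ ρ S n → ren ρ (S ⟨ var (depth S + n) ⟩) ≡ renCtx ρ S ⟨ var (depth S + ρ n) ⟩
  ren-plug-var ρ □ n          = refl
  ren-plug-var ρ (appL S u) n = cong (λ z → app z _) (ren-plug-var ρ S n)
  ren-plug-var ρ (appR u S) n = cong (app _) (ren-plug-var ρ S n)
  ren-plug-var ρ (esL S u) n  = cong (λ z → es z _) (
    trans (cong (λ y → ren (ext ρ) (S ⟨ var y ⟩)) (sym (+-suc (depth S) n)))
          (trans (ren-plug-var (ext ρ) S (suc n))
                 (cong (λ y → renCtx (ext ρ) S ⟨ var y ⟩) (+-suc (depth S) (ρ n)))))

  depth-ren : ∀ ρ S → depth (renCtx ρ S) ≡ depth S
  depth-ren ρ □          = refl
  depth-ren ρ (appL S u) = depth-ren ρ S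
  depth-ren ρ (appR u S) = depth-ren ρ S
  depth-ren ρ (esL S u)  = cong suc (depth-ren (ext ρ) S)

  inner-ren : ∀ m ρ S → inner m (renCtx ρ S) ≡ inner m S
  inner-ren m ρ □          = refl
  inner-ren m ρ (appL S u) = inner-ren hd ρ S
  inner-ren m ρ (appR u S) = inner-ren top ρ S
  inner-ren m ρ (esL S u)  = inner-ren m (ext ρ) S

  ev-ren : ∀ {ρ γ γ'} → Along ρ γ γ' → ∀ S → Ev γ S → Ev γ' (renCtx ρ S)
  ev-ren e □ p                = tt
  ev-ren e (appL S u) (f , p) = (λ q → f (trans (stat-ren e u) q)) , ev-ren e S p
  ev-ren e (appR u S) p       = ev-ren e S p
  ev-ren e (esL S u) (f , p)  =
    (λ q → f (trans (stat-ren e u) q)) , ev-ren (along-ext (stat-ren e u) e) S p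

  renCtx-id : ∀ {ρ} → (∀ x → ρ x ≡ x) → ∀ S → renCtx ρ S ≡ S
  renCtx-id e □          = refl
  renCtx-id e (appL S u) = cong₂ appL (renCtx-id e S) (ren-id e u)
  renCtx-id e (appR u S) = cong₂ appR (ren-id e u) (renCtx-id e S)
  renCtx-id e (esL S u)  = cong₂ esL (renCtx-id (ext-id e) S) (ren-id e u)

  ext-ren : ∀ {ρ₁ ρ₂ ρ₃} → (∀ x → ρ₁ (ρ₂ x) ≡ ρ₃ x) → ∀ x → ext ρ₁ (ext ρ₂ x) ≡ ext ρ₃ x
  ext-ren e zero    = refl
  ext-ren e (suc x) = cong suc (e x)

  renCtx-ren : ∀ {ρ₁ ρ₂ ρ₃} → (∀ x → ρ₁ (ρ₂ x) ≡ ρ₃ x) →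
               ∀ S → renCtx ρ₁ (renCtx ρ₂ S) ≡ renCtx ρ₃ S
  renCtx-ren e □          = refl
  renCtx-ren e (appL S u) = cong₂ appL (renCtx-ren e S) (ren-ren e u)
  renCtx-ren e (appR u S) = cong₂ appR (ren-ren e u) (renCtx-ren e S)
  renCtx-ren e (esL S u)  = cong₂ esL (renCtx-ren (ext-ren e) S) (ren-ren e u)

  replace-here : ∀ {m γ n n' v v'} → m ≡ hd → n ≡ n' → v ≡ v' → Step m γ (rep n v) (var n') v'
  replace-here refl refl refl = here

  UE-plug : ∀ {m γ} L S v → Bare v → stat (within γ ⌈ L ⌉) v ≡ val →
    Ev (stat γ (⌈ L ⌉ ⟨ v ⟩) ∙ γ) S → inner m S ≡ hd →
    UE m γ (S ⟨ var (depth S) ⟩) (⌈ L ⌉ ⟨ v ⟩)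
       (⌈ L ⌉ ⟨ es (renCtx (ext (depth ⌈ L ⌉ +_)) S ⟨ wk (suc (depth S)) v ⟩) v ⟩)
  UE-plug {m} {γ} □ S v b p e i =
    subst (λ z → UE m γ (S ⟨ var (depth S) ⟩) v (es (z ⟨ wk (suc (depth S)) v ⟩) v))
          (sym (renCtx-id (ext-id (λ _ → refl)) S))
          (here b p (Step-plug S e (replace-here i (+-identityʳ _) (wk-wk (depth S) v))))
  UE-plug {m} {γ} (esL L w) S v b p e i =
    esL (subst₂ (λ y z → UE m (stat γ w ∙ γ) y (⌈ L ⌉ ⟨ v ⟩) (⌈ L ⌉ ⟨ es z v ⟩)) body result
          (UE-plug L (renCtx (ext suc) S) v b p (ev-ren (along-up refl) S e)
                   (trans (inner-ren m (ext suc) S) i)))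
    where
    body : renCtx (ext suc) S ⟨ var (depth (renCtx (ext suc) S)) ⟩ ≡ ren (ext suc) (S ⟨ var (depth S) ⟩)
    body = sym (trans (cong (λ d → ren (ext suc) (S ⟨ var d ⟩)) (sym (+-identityʳ (depth S))))
               (trans (ren-plug-var (ext suc) S 0)
                      (cong (λ d → renCtx (ext suc) S ⟨ var d ⟩)
                            (trans (+-identityʳ (depth S)) (sym (depth-ren (ext suc) S))))))
    result : renCtx (ext (depth ⌈ L ⌉ +_)) (renCtx (ext suc) S) ⟨ wk (suc (depth (renCtx (ext suc) S))) v ⟩
           ≡ renCtx (ext (suc (depth ⌈ L ⌉) +_)) S ⟨ wk (suc (depth S)) v ⟩
    result = cong₂ (λ C d → C ⟨ wk (suc d) v ⟩)
                   (renCtx-ren (ext-ren (+-suc (depth ⌈ L ⌉))) S) (depth-ren (ext suc) S)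

  UE-split : ∀ {m γ t u r} → UE m γ t u r →
    ∃[ L ] ∃[ v ] (u ≡ ⌈ L ⌉ ⟨ v ⟩ × Bare v × stat (within γ ⌈ L ⌉) v ≡ val)
  UE-split (here b p s) = □ , _ , refl , b , p
  UE-split (esL {w = w} p) with UE-split p
  ... | L , v , refl , b , q = esL L w , v , refl , b , q

  data Root : Mode → (ℕ → Status) → Act → Tm → Tm → Set where
    here : ∀ {m γ n v} → m ≡ hd → Root m γ (rep n v) (var n) v
    um   : ∀ {m γ t u r} → stat γ u ≢ none → UM t u r → Root m γ (β multiplicative) (app t u) r
    ue   : ∀ {m γ t u r} → UE m γ t u r → Root m γ (β exponential) (es t u) r

  record Decomposition (m : Mode) (γ : ℕ → Status) (κ : Act) (t t' : Tm) : Set where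
    constructor decomposition
    field
      ctx           : ShCtx
      {redex}       : Tm
      {reduct}      : Tm
      redex-eq      : t ≡ ctx ⟨ redex ⟩
      reduct-eq     : t' ≡ ctx ⟨ reduct ⟩
      ctx-evaluable : Ev γ ctx
      redex-good    : Good (within γ ctx) redex
      root          : Root (inner m ctx) (within γ ctx) (renA (depth ctx +_) κ) redex reduct

  Root-act : ∀ {m γ κ κ' t t'} → κ ≡ κ' → Root m γ κ t t' → Root m γ κ' t t'
  Root-act refl r = r

  decompose : ∀ {m γ κ t t'} → Good γ t → Step m γ κ t t' → Decomposition m γ κ t t'
  decompose {κ = κ} g here =
    decomposition □ refl refl tt g (Root-act (sym (renA-id (λ _ → refl) κ)) (here refl))
  decompose g (um f p) = decomposition □ refl refl tt g (um f p)
  decompose g (ue p) = decomposition □ refl refl tt g (ue p)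
  decompose (g , h) (appL {u = u} f s) with decompose g s
  ... | decomposition S refl refl e g' r = decomposition (appL S u) refl refl (f , e) g' r
  decompose (g , h) (appR {t = t} s) with decompose h s
  ... | decomposition S refl refl e g' r = decomposition (appR t S) refl refl e g' r
  decompose {κ = κ} (g , f , h) (esL {u = u} s) with decompose h s
  ... | decomposition S refl refl e g' r =
    decomposition (esL S u) refl refl (f , e) g' (Root-act (renA-ren (+-suc (depth S)) κ) r)

  good-⌈⌉ : ∀ {γ t} L → Good γ (⌈ L ⌉ ⟨ t ⟩) → Ev γ ⌈ L ⌉
  good-⌈⌉ □ g                 = tt
  good-⌈⌉ (esL L u) (_ , f , g) = f , good-⌈⌉ L g

  UE-unique : ∀ {m γ t u r r'} → UE m γ t u r → UE m γ t u r' → r ≡ r'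
  UE-unique {t = t} {u} p q = UE-deterministic t u (λ x → x) (UE-body e p) (UE-body e q)
    where
    e = sym (ren-id (λ _ → refl) t)

  bare-notES : ∀ {v} → Bare v → ¬ (∃[ u ] ∃[ w ] v ≡ es u w)
  bare-notES (var x) (_ , _ , ())
  bare-notES (lam t) (_ , _ , ())

  notES-bare : ∀ {γ} v → ¬ (∃[ u ] ∃[ w ] v ≡ es u w) → stat γ v ≡ val → Bare v
  notES-bare (var x) n p   = var x
  notES-bare (lam t) n p   = lam t
  notES-bare (app t u) n p = ⊥-elim (appS≢val _ _ p)
  notES-bare (es t u) n p  = ⊥-elim (n (t , u , refl))

  Step⇒⊸ : ∀ {k t t'} → Good ∅ t → Step top ∅ (β k) t t' → t ⊸[ k ] t'
  Step⇒⊸ {multiplicative} g s with decompose g s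
  ... | decomposition S refl refl e (g' , _) (um {u = u} f p) with UM-split p
  ... | L , b , refl , refl =
    um S L b u ( ev-evaluable _ (S ∘ appL ⌈ L ⌉ u) refl (ev-∘ S e (f , good-⌈⌉ L g'))
               , S , L , u , refl)
  Step⇒⊸ {exponential} g s with decompose g s
  ... | decomposition S refl refl e (_ , f , g') (ue {t = t} p) with UE-split p | UE-step t (var 0) p
  ... | L , v , refl , b , q | _ , s' with decompose g' s'
  ... | decomposition S' refl refl e' g'' (here i) =
    subst₂ (λ d z → S ⟨ es (S' ⟨ var d ⟩) (⌈ L ⌉ ⟨ v ⟩) ⟩ ⊸[ exponential ] S ⟨ z ⟩)
      (sym (+-identityʳ (depth S')))
      (UE-unique (UE-plug L S' v b q e' i)
                 (UE-body (cong (λ d → S' ⟨ var d ⟩) (+-identityʳ (depth S'))) p))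
      (ue S S' L v
        ( ev-evaluable _ (S ∘ esL S' (⌈ L ⌉ ⟨ v ⟩)) refl (ev-∘ S e (f , e'))
        , top-applicative _ (trans (inner-∘ top S _) i))
        (bare-notES b)
        (stat-value (isλ-↓[] v (S ∘ ⌈ L ⌉))
          (trans (stat-↓[] ∅ v (S ∘ ⌈ L ⌉)) (trans (cong (λ γ → stat γ v) (within-∘ ∅ S ⌈ L ⌉)) q))))

  ⊸⇒Step : ∀ {k t t'} → t ⊸[ k ] t' → Step top ∅ (β k) t t'
  ⊸⇒Step (um S L t u (e , _)) with ev-∘⁻ S (evaluable-ev e)
  ... | e₁ , f , _ = Step-plug S e₁ (um f (UM-plug L t u))
  ⊸⇒Step (ue S S' L u (e , a) n v) with ev-∘⁻ S (evaluable-ev e)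
  ... | e₁ , _ , e₂ = Step-plug S e₁ (ue (UE-plug L S' u (notES-bare u n q) q e₂
                        (trans (sym (inner-∘ top S _)) (applicative-inner _ top a))))
    where
    q : stat (within (within ∅ S) ⌈ L ⌉) u ≡ val
    q = trans (cong (λ γ → stat γ u) (sym (within-∘ ∅ S ⌈ L ⌉)))
              (trans (sym (stat-↓[] ∅ u (S ∘ ⌈ L ⌉))) (value-stat v))

  ⊸-deterministic : ∀ {t k₁ k₂ t₁ t₂} → t ⊸[ k₁ ] t₁ → t ⊸[ k₂ ] t₂ → k₁ ≡ k₂ × t₁ ≡ t₂
  ⊸-deterministic {t} {t₁ = t₁} {t₂} p q
    with Step-deterministic t (λ x → x) tt tt (id-step (⊸⇒Step p)) (id-step (⊸⇒Step q))
    where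
    id-step : ∀ {κ t'} → Step top ∅ κ t t' → Step top ∅ κ (ren (λ x → x) t) t'
    id-step {κ} {t'} = subst (λ z → Step top ∅ κ z t') (sym (ren-id (λ _ → refl) t))
  ... | refl , e = refl , e refl

  ≋-bisimulation : ∀ {t u k t'} → Good ∅ t → t ≋ u → t ⊸[ k ] t' → ∃[ u' ] (u ⊸[ k ] u' × t' ≋ u')
  ≋-bisimulation g e s with step (stable-id (proj₁ (bisim e))) (⊸⇒Step s)
  ... | u' , s' , e' = u' , Step⇒⊸ (good-≋ e g) s' , e'

  -- Free variables and names

  fv-ren : ∀ {x} ρ t → x ∈fv t → ρ x ∈fv ren ρ t
  fv-ren ρ (var y) refl           = refl
  fv-ren ρ (lam t) p              = fv-ren (ext ρ) t p
  fv-ren ρ (app t u) (inj₁ p)     = inj₁ (fv-ren ρ t p)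
  fv-ren ρ (app t u) (inj₂ p)     = inj₂ (fv-ren ρ u p)
  fv-ren ρ (es t u) (inj₁ p)      = inj₁ (fv-ren (ext ρ) t p)
  fv-ren ρ (es t u) (inj₂ p)      = inj₂ (fv-ren ρ u p)

  ext-cong-fv : ∀ {ρ ρ'} t → (∀ x → suc x ∈fv t → ρ x ≡ ρ' x) → ∀ x → x ∈fv t → ext ρ x ≡ ext ρ' x
  ext-cong-fv t e zero    p = refl
  ext-cong-fv t e (suc x) p = cong suc (e x p)

  ren-cong-fv : ∀ {ρ ρ'} t → (∀ x → x ∈fv t → ρ x ≡ ρ' x) → ren ρ t ≡ ren ρ' t
  ren-cong-fv (var x) e   = cong var (e x refl)
  ren-cong-fv (cst a) e   = refl
  ren-cong-fv (lam t) e   = cong lam (ren-cong-fv t (ext-cong-fv t e))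
  ren-cong-fv (app t u) e =
    cong₂ app (ren-cong-fv t (λ x p → e x (inj₁ p))) (ren-cong-fv u (λ x p → e x (inj₂ p)))
  ren-cong-fv (es t u) e  =
    cong₂ es (ren-cong-fv t (ext-cong-fv t (λ x p → e x (inj₁ p)))) (ren-cong-fv u (λ x p → e x (inj₂ p)))

  stat-cong-fv : ∀ {γ γ'} t → (∀ x → x ∈fv t → γ x ≡ γ' x) → stat γ t ≡ stat γ' t
  stat-cong-fv (var x) e   = e x refl
  stat-cong-fv (cst a) e   = refl
  stat-cong-fv (lam t) e   = refl
  stat-cong-fv (app t u) e =
    cong₂ appS (stat-cong-fv t (λ x p → e x (inj₁ p))) (stat-cong-fv u (λ x p → e x (inj₂ p)))
  stat-cong-fv (es t u) e  = stat-cong-fv t λ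
    { zero    p → stat-cong-fv u (λ x p → e x (inj₂ p))
    ; (suc x) p → e x (inj₁ p) }

  capture-same : ∀ x → capture x x ≡ 0
  capture-same x with x ≟ x
  ... | yes _ = refl
  ... | no n  = ⊥-elim (n refl)

  capture-other : ∀ {x y} → y ≢ x → capture x y ≡ suc y
  capture-other {x} {y} n with y ≟ x
  ... | yes e = ⊥-elim (n e)
  ... | no _  = refl

  bind-fresh : ∀ {x} t → ¬ (x ∈fv t) → bind x t ≡ wk 1 t
  bind-fresh t n = ren-cong-fv t (λ y p → capture-other λ { refl → n p })

  isλ-⌊⌋ : ∀ t → IsλTerm ⌊ t ⌋
  isλ-⌊⌋ (var x)   = var x
  isλ-⌊⌋ (cst a)   = cst a
  isλ-⌊⌋ (ƛ x t)   = lam (isλ-ren _ (isλ-⌊⌋ t))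
  isλ-⌊⌋ (app t u) = app (isλ-⌊⌋ t) (isλ-⌊⌋ u)

  record Naming (t : Tm) (n : ℕ) : Set where
    constructor naming
    field
      term      : Code
      {bound}   : ℕ
      correct   : ⌊ term ⌋ ≡ t
      distinct  : Unique (bnCode term)
      above     : All (n ≤_) (bnCode term)
      below     : All (_< bound) (bnCode term)
      ordered   : n ≤ bound

  separated : ∀ {n xs ys} → All (_< n) xs → All (n ≤_) ys → ∀ {x} → ¬ (x ∈ xs × x ∈ ys)
  separated p q (i , j) = <-irrefl refl (≤-trans (All.lookup p i) (All.lookup q j))

  -- Binders are named n, n + 1, … from the outside in and from left to right.
  name : ∀ {t} ρ n → IsλTerm t → (∀ x → x ∈fv t → ρ x < n) → Naming (ren ρ t) n
  name ρ n (var x) f = naming (var (ρ x)) refl [] [] [] (≤-refl {n})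
  name ρ n (cst a) f = naming (cst a) refl [] [] [] (≤-refl {n})
  name {lam t} ρ n (lam p) f with name ρ' (suc n) p f'
    where
    ρ' : ℕ → ℕ
    ρ' zero    = n
    ρ' (suc x) = ρ x
    f' : ∀ x → x ∈fv t → ρ' x < suc n
    f' zero    q = n<1+n n
    f' (suc x) q = m<n⇒m<1+n (f x q)
  ... | naming c e d a b o =
    naming (ƛ n c)
      (cong lam (trans (cong (bind n) e) (trans (ren-ren (λ _ → refl) t) (ren-cong-fv t pointwise))))
      (All.map (λ { q refl → <-irrefl refl q }) a ∷ d)
      (≤-refl ∷ All.map (≤-trans (n≤1+n n)) a)
      (o ∷ b)
      (<⇒≤ o)
    where
    pointwise : ∀ x → x ∈fv t → _ ≡ ext ρ x
    pointwise zero    q = capture-same n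
    pointwise (suc x) q = capture-other λ e' → <-irrefl e' (f x q)
  name ρ n (app p q) f with name ρ n p (λ x i → f x (inj₁ i))
  ... | naming c {m} e d a b o with name ρ m q (λ x i → ≤-trans (f x (inj₂ i)) o)
  ... | naming c' e' d' a' b' o' =
    naming (app c c') (cong₂ app e e') (unique-++⁺ d d' (separated b a'))
      (++⁺ a (All.map (≤-trans o) a'))
      (++⁺ (All.map (λ i → ≤-trans i o') b) b')
      (≤-trans o o')

  upper-bound : ∀ (xs : List ℕ) → ∃[ n ] All (_< n) xs
  upper-bound []       = 0 , []
  upper-bound (x ∷ xs) with upper-bound xs
  ... | n , p = suc x ⊔ n , m≤m⊔n (suc x) n ∷ All.map (λ q → ≤-trans q (m≤n⊔m (suc x) n)) p

  -- The machine invariant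

  dom : Env → List Name
  dom []                  = []
  dom ([ x ← φ ^ l ] ∷ E) = x ∷ dom E

  envStat : Env → ℕ → Status
  envStat []                  = ∅
  envStat ([ x ← φ ^ l ] ∷ E) y = (stat (envStat E) (decodeItem φ) ∙ envStat E) (capture x y)

  labStat : Lab → Status
  labStat 𝗏 = val
  labStat 𝖠 = inert

  labStat≢none : ∀ l → labStat l ≢ none
  labStat≢none 𝗏 ()
  labStat≢none 𝖠 ()

  Scoped : Env → Tm → Set
  Scoped E t = ∀ y → y ∈fv t → y ∈ dom E

  ValueIsCode : Item → Lab → Set
  ValueIsCode φ 𝗏 = ∃[ t ] φ ≡ code t
  ValueIsCode φ 𝖠 = ⊤

  record ItemOk (E : Env) (φ : Item) (l : Lab) : Set where
    constructor itemOk
    field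
      scoped  : Scoped E (decodeItem φ)
      status  : stat (envStat E) (decodeItem φ) ≡ labStat l
      isCode  : ValueIsCode φ l
  open ItemOk

  StackOk : Env → Stack → Set
  StackOk E ε           = ⊤
  StackOk E (φ ^ l ∷ π) = ItemOk E φ l × StackOk E π

  DumpOk : Env → Dump → Set
  DumpOk E ε              = ⊤
  DumpOk E (D ∶⟨ t , π ⟩) = DumpOk E D × Scoped E ⌊ t ⌋ × StackOk E π

  EnvOk : Env → Set
  EnvOk []                  = ⊤
  EnvOk ([ x ← φ ^ l ] ∷ E) = ItemOk E φ l × EnvOk E

  record Invariant (s : State) : Set where
    constructor invariant
    open State s
    field
      wellNamed   : WellNamed s
      dumpOk      : DumpOk env dump
      focusScoped : Scoped env ⌊ focus ⌋
      stackOk     : StackOk env stack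
      envOk       : EnvOk env

  unique-++⁻ʳ : ∀ (xs : List ℕ) {ys} → Unique (xs ++ ys) → Unique ys
  unique-++⁻ʳ []       p       = p
  unique-++⁻ʳ (x ∷ xs) (_ ∷ p) = unique-++⁻ʳ xs p

  all-dom : ∀ {P : ℕ → Set} E → All P (bnEnv E) → All P (dom E)
  all-dom []                  p       = []
  all-dom ([ x ← φ ^ l ] ∷ E) (q ∷ p) = q ∷ all-dom E (++⁻ʳ (bnItem φ) p)

  unique-dom : ∀ E → Unique (bnEnv E) → Unique (dom E)
  unique-dom []                  p       = []
  unique-dom ([ x ← φ ^ l ] ∷ E) (q ∷ p) =
    all-dom E (++⁻ʳ (bnItem φ) q) ∷ unique-dom E (unique-++⁻ʳ (bnItem φ) p)

  wellNamed-dom : ∀ s → WellNamed s → Unique (dom (State.env s))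
  wellNamed-dom (st D t π E) p =
    unique-dom E (unique-++⁻ʳ (bnStack π) (unique-++⁻ʳ (bnCode t) (unique-++⁻ʳ (bnDump D) p)))

  invariant-dom : ∀ s → Invariant s → Unique (dom (State.env s))
  invariant-dom s i = wellNamed-dom s (Invariant.wellNamed i)

  dom-split : ∀ E₁ {x φ l E₂} → x ∈ dom (E₁ ++ [ x ← φ ^ l ] ∷ E₂)
  dom-split []                   = here refl
  dom-split ([ _ ← _ ^ _ ] ∷ E₁) = there (dom-split E₁)

  dom-suffix : ∀ E₁ {x φ l E₂ y} → y ∈ dom E₂ → y ∈ dom (E₁ ++ [ x ← φ ^ l ] ∷ E₂)
  dom-suffix []                   p = there p
  dom-suffix ([ _ ← _ ^ _ ] ∷ E₁) p = there (dom-suffix E₁ p)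

  lookup-ok : ∀ E₁ {x φ l E₂} → EnvOk (E₁ ++ [ x ← φ ^ l ] ∷ E₂) → ItemOk E₂ φ l
  lookup-ok []                   (p , _) = p
  lookup-ok ([ _ ← _ ^ _ ] ∷ E₁) (_ , p) = lookup-ok E₁ p

  lookup-status : ∀ E₁ {x φ l E₂} → EnvOk (E₁ ++ [ x ← φ ^ l ] ∷ E₂) →
    Unique (dom (E₁ ++ [ x ← φ ^ l ] ∷ E₂)) → envStat (E₁ ++ [ x ← φ ^ l ] ∷ E₂) x ≡ labStat l
  lookup-status [] {x} (p , _) u rewrite capture-same x = status p
  lookup-status ([ y ← _ ^ _ ] ∷ E₁) (_ , p) (n ∷ u)
    rewrite capture-other {y} (λ e → All.lookup n (dom-split E₁) (sym e)) = lookup-status E₁ p u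

  lookup-split : ∀ E x → x ∈ dom E → ∃[ E₁ ] ∃[ φ ] ∃[ l ] ∃[ E₂ ] E ≡ E₁ ++ [ x ← φ ^ l ] ∷ E₂
  lookup-split ([ x ← φ ^ l ] ∷ E) .x (here refl) = [] , φ , l , E , refl
  lookup-split (e@([ y ← _ ^ _ ]) ∷ E) x (there i) with lookup-split E x i
  ... | E₁ , φ , l , E₂ , refl = e ∷ E₁ , φ , l , E₂ , refl

  lookup-unique : ∀ E₁ E₁' {x φ l E₂ φ' l' E₂'} → Unique (dom (E₁ ++ [ x ← φ ^ l ] ∷ E₂)) →
    E₁ ++ [ x ← φ ^ l ] ∷ E₂ ≡ E₁' ++ [ x ← φ' ^ l' ] ∷ E₂' → φ ≡ φ'
  lookup-unique [] [] u refl = refl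
  lookup-unique [] (_ ∷ E₁') (n ∷ _) refl = ⊥-elim (All.lookup n (dom-split E₁') refl)
  lookup-unique (_ ∷ E₁) [] (n ∷ _) refl = ⊥-elim (All.lookup n (dom-split E₁) refl)
  lookup-unique ([ y ← _ ^ _ ] ∷ E₁) (_ ∷ E₁') (_ ∷ u) e =
    lookup-unique E₁ E₁' u (∷-injectiveʳ e)

  item-weaken : ∀ {E φ l x ψ k} → All (x ≢_) (dom E) → ItemOk E φ l → ItemOk ([ x ← ψ ^ k ] ∷ E) φ l
  item-weaken {E} {φ} {x = x} {ψ} {k} n (itemOk s p c) =
    itemOk (λ y i → there (s y i)) (trans (sym (stat-cong-fv (decodeItem φ) same)) p) c
    where
    same : ∀ y → y ∈fv decodeItem φ → envStat E y ≡ envStat ([ x ← ψ ^ k ] ∷ E) y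
    same y i rewrite capture-other {x} {y} (λ e → All.lookup n (s y i) (sym e)) = refl

  stack-weaken : ∀ {E x ψ k} π → All (x ≢_) (dom E) → StackOk E π → StackOk ([ x ← ψ ^ k ] ∷ E) π
  stack-weaken ε n p                 = tt
  stack-weaken (φ ^ l ∷ π) n (p , q) = item-weaken n p , stack-weaken π n q

  dump-weaken : ∀ {E x ψ k} D → All (x ≢_) (dom E) → DumpOk E D → DumpOk ([ x ← ψ ^ k ] ∷ E) D
  dump-weaken ε n p                        = tt
  dump-weaken (D ∶⟨ t , π ⟩) n (p , q , r) =
    dump-weaken D n p , (λ y i → there (q y i)) , stack-weaken π n r

  stack-scoped : ∀ {E h} π → StackOk E π → Scoped E h → Scoped E (decodeStack π h)
  stack-scoped ε p s                 = s
  stack-scoped (φ ^ l ∷ π) (p , q) s =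
    stack-scoped π q λ { y (inj₁ i) → s y i ; y (inj₂ i) → scoped p y i }

  status≢none : ∀ {E φ l} → ItemOk E φ l → stat (envStat E) (decodeItem φ) ≢ none
  status≢none {l = l} p q = labStat≢none l (trans (sym (status p)) q)

  stack-inert : ∀ {E h} π → StackOk E π → stat (envStat E) h ≡ inert →
                stat (envStat E) (decodeStack π h) ≡ inert
  stack-inert ε p s                       = s
  stack-inert {E} (φ ^ l ∷ π) (p , q) s =
    stack-inert π q (trans (cong (λ z → appS z _) s) (appS-inert _ (status≢none p)))

  body-scoped : ∀ {E x φ l} t → Scoped E ⌊ ƛ x t ⌋ → Scoped ([ x ← φ ^ l ] ∷ E) ⌊ t ⌋
  body-scoped {x = x} t s y i with y ≟ x
  ... | yes refl = here refl
  ... | no n = there (s y (subst (_∈fv bind x ⌊ t ⌋) (capture-other n) (fv-ren (capture x) ⌊ t ⌋ i)))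

  invariant-initial : ∀ {s} → InitialState s → Invariant s
  invariant-initial (initial t c u) = invariant
    (subst Unique (sym (++-identityʳ (bnCode t))) u) tt (λ y i → ⊥-elim (c y i)) tt tt

  invariant-step : ∀ {s l s'} → Invariant s → Transition s l s' → Invariant s'
  invariant-step {st D (app t u) π E} (invariant w d f p e) c₁ = invariant
    (Unique-resp-↭ (solve 5 (λ D t u π E → (D ⊕ (t ⊕ u) ⊕ π ⊕ E) ⊜ ((D ⊕ t ⊕ π) ⊕ u ⊕ E))
                     ↭-refl (bnDump D) (bnCode t) (bnCode u) (bnStack π) (bnEnv E)) w)
    (d , (λ y i → f y (inj₁ i)) , p) (λ y i → f y (inj₂ i)) tt e
  invariant-step {st D (ƛ x t) (φ ^ l ∷ π) E} (invariant w d f (p , q) e) um = invariant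
    w' (dump-weaken D n d) (body-scoped {φ = φ} {l} t f) (stack-weaken π n q) (p , e)
    where
    w' : WellNamed (st D t π ([ x ← φ ^ l ] ∷ E))
    w' = Unique-resp-↭
      (solve 6 (λ D x t φ π E → (D ⊕ (x ⊕ t) ⊕ (φ ⊕ π) ⊕ E) ⊜ (D ⊕ t ⊕ π ⊕ (x ⊕ φ ⊕ E)))
        ↭-refl (bnDump D) (x ∷ []) (bnCode t) (bnItem φ) (bnStack π) (bnEnv E)) w
    n : All (x ≢_) (dom E)
    n with wellNamed-dom (st D t π ([ x ← φ ^ l ] ∷ E)) w'
    ... | n ∷ _ = n
  invariant-step {st (D ∶⟨ t , π ⟩) u ε E} (invariant w (d , g , q) f p e) c₂ = invariant
    (Unique-resp-↭ (solve 5 (λ D t π u E → ((D ⊕ t ⊕ π) ⊕ u ⊕ E) ⊜ (D ⊕ t ⊕ (u ⊕ π) ⊕ E))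
                     ↭-refl (bnDump D) (bnCode t) (bnStack π) (bnCode u) (bnEnv E)) w)
    d g (itemOk f refl (_ , refl) , q) e
  invariant-step {st (D ∶⟨ t , π ⟩) _ π' E} (invariant w (d , g , q) f p e) c₃ = invariant
    (Unique-resp-↭ (solve 5 (λ D t π π' E → ((D ⊕ t ⊕ π) ⊕ π' ⊕ E) ⊜ (D ⊕ t ⊕ (π' ⊕ π) ⊕ E))
                     ↭-refl (bnDump D) (bnCode t) (bnStack π) (bnStack π') (bnEnv E)) w)
    d g (itemOk (stack-scoped π' p f) (stack-inert π' p refl) tt , q) e
  invariant-step {st (D ∶⟨ t , π ⟩) (var x) π' E} (invariant w (d , g , q) f p e) (c₄ E₁ φ E₂ refl) = invariant
    (Unique-resp-↭ (solve 5 (λ D t π π' E → ((D ⊕ t ⊕ π) ⊕ π' ⊕ E) ⊜ (D ⊕ t ⊕ (π' ⊕ π) ⊕ E))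
                     ↭-refl (bnDump D) (bnCode t) (bnStack π) (bnStack π') (bnEnv E)) w)
    d g (itemOk (stack-scoped π' p f) (stack-inert π' p s) tt , q) e
    where
    s = lookup-status E₁ e (wellNamed-dom (st (D ∶⟨ t , π ⟩) (var x) π' E) w)
  invariant-step {st (D ∶⟨ t , π ⟩) (var x) ε E} (invariant w (d , g , q) f p e) (c₅ E₁ u E₂ refl) = invariant
    (Unique-resp-↭ (solve 4 (λ D t π E → ((D ⊕ t ⊕ π) ⊕ E) ⊜ (D ⊕ t ⊕ π ⊕ E))
                     ↭-refl (bnDump D) (bnCode t) (bnStack π) (bnEnv E)) w)
    d g (itemOk f s (_ , refl) , q) e
    where
    s = lookup-status E₁ e (wellNamed-dom (st (D ∶⟨ t , π ⟩) (var x) ε E) w)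
  invariant-step (invariant w d f p e) (ue E₁ u E₂ uᵅ refl α w') = invariant
    w' d (λ y i → dom-suffix E₁ (scoped (lookup-ok E₁ e) y (subst (y ∈fv_) α i))) p e

  open Machine GLAMoUr using (Reachable; CommutesFrom; _⇝[_]_)

  reachable-invariant : ∀ {s} → Reachable s → Invariant s
  reachable-invariant (_ , i , steps) = go (invariant-initial i) steps
    where
    go : ∀ {s s'} → Invariant s → Star (λ s₁ s₂ → ∃[ l ] s₁ ⇝[ l ] s₂) s s' → Invariant s'
    go i ε              = i
    go i ((_ , t) ◅ ts) = go (invariant-step i t) ts

  -- Decoding

  isλ-stack : ∀ π {h} → IsλTerm h → IsλTerm (decodeStack π h)
  isλ-item  : ∀ φ → IsλTerm (decodeItem φ)
  isλ-stack ε p           = p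
  isλ-stack (φ ^ l ∷ π) p = isλ-stack π (app p (isλ-item φ))
  isλ-item (code t)   = isλ-⌊⌋ t
  isλ-item (pair t π) = isλ-stack π (isλ-⌊⌋ t)

  isλ-dump : ∀ D {h} → IsλTerm h → IsλTerm (decodeDump D h)
  isλ-dump ε p              = p
  isλ-dump (D ∶⟨ t , π ⟩) p = isλ-dump D (isλ-stack π (app (isλ-⌊⌋ t) p))

  good-env : ∀ {h} E → EnvOk E → Good (envStat E) h → Good ∅ (decodeEnv E h)
  good-env [] p g = g
  good-env {h} ([ x ← φ ^ l ] ∷ E) (p , q) g =
    good-env E q (isλ-good (isλ-item φ) , status≢none p , good-ren (λ _ → refl) h g)

  good-decode : ∀ s → Invariant s → Good ∅ (decode s)
  good-decode (st D t π E) (invariant _ _ _ _ e) =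
    good-env E e (isλ-good (isλ-dump D (isλ-stack π (isλ-⌊⌋ t))))

  stat-env : ∀ E h → stat ∅ (decodeEnv E h) ≡ stat (envStat E) h
  stat-env [] h                    = refl
  stat-env ([ x ← φ ^ l ] ∷ E) h =
    trans (stat-env E (es (bind x h) (decodeItem φ))) (sym (stat-ren (λ _ → refl) h))

  -- In every mode, since the position of the focus in its stack is not known.
  Steps : (ℕ → Status) → Act → Tm → Tm → Set
  Steps γ κ t t' = ∀ m → Step m γ κ t t'

  step-stack : ∀ {E κ h h'} π → StackOk E π → Steps (envStat E) κ h h' →
               Steps (envStat E) κ (decodeStack π h) (decodeStack π h')
  step-stack ε p s                 = s
  step-stack (φ ^ l ∷ π) (p , q) s = step-stack π q (λ m → appL (status≢none p) (s hd))

  step-dump : ∀ {E κ h h'} D → DumpOk E D → Steps (envStat E) κ h h' →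
              Steps (envStat E) κ (decodeDump D h) (decodeDump D h')
  step-dump ε p s                        = s
  step-dump (D ∶⟨ t , π ⟩) (p , _ , q) s = step-dump D p (step-stack π q (λ m → appR (s top)))

  step-env : ∀ {m k h h'} E → Step m (envStat E) (β k) h h' →
             Step m ∅ (β k) (decodeEnv E h) (decodeEnv E h')
  step-env [] s                  = s
  step-env ([ x ← φ ^ l ] ∷ E) s = step-env E (esL (Step-ren (λ _ → refl) s))

  Fresh : Name → Env → Set
  Fresh x E = All (x ≢_) (dom E)

  scoped-fresh : ∀ {x E} t → Fresh x E → Scoped E t → ¬ (x ∈fv t)
  scoped-fresh t n s i = All.lookup n (s _ i) refl

  code-bare : ∀ {γ} u → stat γ ⌊ u ⌋ ≡ val → Bare ⌊ u ⌋
  code-bare u p = notES-bare ⌊ u ⌋ (notES (isλ-⌊⌋ u)) p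
    where
    notES : ∀ {t} → IsλTerm t → ¬ (∃[ t' ] ∃[ w ] t ≡ es t' w)
    notES () (_ , _ , refl)

  step-env-rep : ∀ {m x u h h'} E₁ {E₂} → let E = E₁ ++ [ x ← code u ^ 𝗏 ] ∷ E₂ in
    EnvOk E → Unique (dom E) → Step m (envStat E) (rep x ⌊ u ⌋) h h' →
    Step m ∅ (β exponential) (decodeEnv E h) (decodeEnv E h')
  step-env-rep {x = x} {u} [] {E₂} (p , q) (n ∷ _) s =
    step-env E₂ (ue (here (code-bare u (status p)) (status p)
      (Step-act (cong₂ rep (capture-same x) (bind-fresh ⌊ u ⌋ (scoped-fresh {E = E₂} ⌊ u ⌋ n (scoped p))))
        (Step-ren (λ _ → refl) s))))
  step-env-rep {x = x} {u} ([ y ← φ ^ l ] ∷ E₁) {E₂} (p , q) (n ∷ n') s =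
    step-env-rep E₁ q n' (esL (Step-act (cong₂ rep (capture-other x≢y) (bind-fresh ⌊ u ⌋ y∉u))
                                        (Step-ren (λ _ → refl) s)))
    where
    x≢y : x ≢ y
    x≢y e = All.lookup n (dom-split E₁) (sym e)
    y∉u : ¬ (y ∈fv ⌊ u ⌋)
    y∉u = scoped-fresh {E = E₁ ++ [ x ← code u ^ 𝗏 ] ∷ E₂} ⌊ u ⌋ n
            (λ z i → dom-suffix E₁ (scoped (lookup-ok E₁ q) z i))

  ≋-reflexive : ∀ {t u} → t ≡ u → t ≋ u
  ≋-reflexive refl = ≋-refl

  ≋-stack : ∀ {h h'} π → h ≋ h' → decodeStack π h ≋ decodeStack π h'
  ≋-stack ε p           = p
  ≋-stack (φ ^ l ∷ π) p = ≋-stack π (appL _ p)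

  ≋-dump : ∀ {h h'} D → h ≋ h' → decodeDump D h ≋ decodeDump D h'
  ≋-dump ε p              = p
  ≋-dump (D ∶⟨ t , π ⟩) p = ≋-dump D (≋-stack π (appR _ p))

  ≋-env : ∀ {h h'} E → h ≋ h' → decodeEnv E h ≋ decodeEnv E h'
  ≋-env [] p                  = p
  ≋-env ([ x ← φ ^ l ] ∷ E) p = ≋-env E (esL _ (≋-ren (capture x) p))

  es-out-stack : ∀ {E x h u} π → StackOk E π → Fresh x E →
                 decodeStack π (es (bind x h) u) ≋ es (bind x (decodeStack π h)) u
  es-out-stack ε p n = ≋-refl
  es-out-stack {E} {x} {h} {u} (φ ^ l ∷ π) (p , q) n = ≋-trans
    (≋-stack π (≋-trans (≋-sym (distL (bind x h) (decodeItem φ) u))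
      (≋-reflexive (cong (λ z → es (app (bind x h) z) u)
        (sym (bind-fresh (decodeItem φ) (scoped-fresh {E = E} (decodeItem φ) n (scoped p))))))))
    (es-out-stack π q n)

  es-out-dump : ∀ {E x h u} D → DumpOk E D → Fresh x E →
                decodeDump D (es (bind x h) u) ≋ es (bind x (decodeDump D h)) u
  es-out-dump ε p n = ≋-refl
  es-out-dump {E} {x} {h} {u} (D ∶⟨ t , π ⟩) (p , s , q) n = ≋-trans
    (≋-dump D (≋-trans
      (≋-stack π (≋-trans (≋-sym (distR ⌊ t ⌋ (bind x h) u))
        (≋-reflexive (cong (λ z → es (app z (bind x h)) u)
          (sym (bind-fresh ⌊ t ⌋ (scoped-fresh {E = E} ⌊ t ⌋ n s)))))))
      (es-out-stack π q n)))
    (es-out-dump D p n)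

  decode-um : ∀ {s s'} → Invariant s → s ⇝[ um ] s' →
              ∃[ t ] (decode s ⊸[ multiplicative ] t × t ≋ decode s')
  decode-um {s} i@(invariant w d f (p , q) e) (um {D} {x} {t} {φ} {l} {π} {E}) =
    _ , Step⇒⊸ (good-decode s i)
          (step-env E (step-dump D d (step-stack π q (λ m → um (status≢none p) here)) top))
      , ≋-env E (≋-trans (≋-dump D (es-out-stack π q n)) (es-out-dump D d n))
    where
    n : Fresh x E
    n with invariant-dom (st D t π ([ x ← φ ^ l ] ∷ E)) (invariant-step i um)
    ... | n ∷ _ = n

  decode-ue : ∀ {s s'} → Invariant s → s ⇝[ ue ] s' → decode s ⊸[ exponential ] decode s'
  decode-ue {s} i@(invariant w d f (p , q) e) (ue {D} {x} {φ} {l} {π} E₁ u E₂ uᵅ refl α w') =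
    Step⇒⊸ (good-decode s i)
      (step-env-rep E₁ e (wellNamed-dom s w)
        (step-dump D d (step-stack π q (λ m → appL (status≢none p) (replace-here refl refl (sym α)))) top))

  decode-commutative : ∀ {s l s'} → mrole l ≡ commutative → s ⇝[ l ] s' → decode s ≡ decode s'
  decode-commutative r c₁             = refl
  decode-commutative r c₂             = refl
  decode-commutative r c₃             = refl
  decode-commutative r (c₄ _ _ _ _)   = refl
  decode-commutative r (c₅ _ _ _ _)   = refl

  decode-principal : ∀ {s l k s'} → Invariant s → mrole l ≡ principal k → s ⇝[ l ] s' →
                     ∃[ t ] (decode s ⊸[ k ] t × t ≋ decode s')
  decode-principal {l = um} i refl t = decode-um i t
  decode-principal {l = ue} i refl t = _ , decode-ue i t , ≋-refl

  -- The machine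

  lookups-agree : ∀ {E} E₁ E₁' {x φ l E₂ φ' l' E₂'} → EnvOk E → Unique (dom E) →
    E ≡ E₁ ++ [ x ← φ ^ l ] ∷ E₂ → E ≡ E₁' ++ [ x ← φ' ^ l' ] ∷ E₂' → labStat l ≡ labStat l'
  lookups-agree E₁ E₁' {φ = φ} {l' = l'} {E₂'} ok u refl e =
    trans (sym (lookup-status E₁ ok u))
      (trans (cong (λ E → envStat E _) e) (lookup-status E₁' (subst EnvOk e ok) (subst (λ E → Unique (dom E)) e u)))

  machine-deterministic : ∀ {s l₁ l₂ s₁ s₂} → Invariant s →
    s ⇝[ l₁ ] s₁ → s ⇝[ l₂ ] s₂ → l₁ ≡ l₂ × SameUpToα s₁ s₂
  machine-deterministic i c₁ c₁ = refl , focusα refl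
  machine-deterministic i um um = refl , focusα refl
  machine-deterministic i c₂ c₂ = refl , focusα refl
  machine-deterministic i c₃ c₃ = refl , focusα refl
  machine-deterministic i (c₄ _ _ _ _) (c₄ _ _ _ _) = refl , focusα refl
  machine-deterministic {s} i (c₄ E₁ _ _ e) (c₅ E₁' _ _ e')
    with lookups-agree E₁ E₁' (Invariant.envOk i) (invariant-dom s i) e e'
  ... | ()
  machine-deterministic {s} i (c₄ E₁ _ _ e) (ue E₁' _ _ _ e' _ _)
    with lookups-agree E₁ E₁' (Invariant.envOk i) (invariant-dom s i) e e'
  ... | ()
  machine-deterministic {s} i (c₅ E₁ _ _ e) (c₄ E₁' _ _ e')
    with lookups-agree E₁ E₁' (Invariant.envOk i) (invariant-dom s i) e e'
  ... | ()
  machine-deterministic i (c₅ _ _ _ _) (c₅ _ _ _ _) = refl , focusα refl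
  machine-deterministic {s} i (ue E₁ _ _ _ e _ _) (c₄ E₁' _ _ e')
    with lookups-agree E₁ E₁' (Invariant.envOk i) (invariant-dom s i) e e'
  ... | ()
  machine-deterministic {s} i (ue E₁ u E₂ _ refl α _) (ue E₁' u' E₂' _ e' α' _)
    with lookup-unique E₁ E₁' (invariant-dom s i) e'
  ... | refl = refl , focusα (trans α (sym α'))

  sizeCode : Code → ℕ
  sizeCode (var x)   = 1
  sizeCode (cst a)   = 1
  sizeCode (ƛ x t)   = 1
  sizeCode (app t u) = suc (sizeCode u + sizeCode t)

  sizeDump : Dump → ℕ
  sizeDump ε              = 0
  sizeDump (D ∶⟨ t , π ⟩) = sizeCode t + sizeDump D

  measure : State → ℕ
  measure (st D t π E) = sizeCode t + sizeDump D

  measure-decreases : ∀ {s s'} → CommutesFrom s' s → measure s' < measure s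
  measure-decreases (_ , r , c₁ {D} {t} {u}) = ≤-reflexive (cong suc (sym (+-assoc (sizeCode u) (sizeCode t) (sizeDump D))))
  measure-decreases (_ , r , c₂)             = ≤-refl
  measure-decreases (_ , r , c₃)             = ≤-refl
  measure-decreases (_ , r , c₄ _ _ _ _)     = ≤-refl
  measure-decreases (_ , r , c₅ _ _ _ _)     = ≤-refl

  commutative-terminates : ∀ s → Acc CommutesFrom s
  commutative-terminates s =
    Subrelation.accessible measure-decreases (accessible measure (<-wellFounded (measure s)))

  rename-fresh : ∀ D u π E → Scoped E ⌊ u ⌋ → Unique (bnDump D ++ bnStack π ++ bnEnv E) →
                 ∃[ uᵅ ] (uᵅ =α u × WellNamed (st D uᵅ π E))
  rename-fresh D u π E s w with upper-bound (bnDump D ++ bnStack π ++ bnEnv E)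
  ... | n , b with name (λ x → x) n (isλ-⌊⌋ u) (λ x i → All.lookup dom<n (s x i))
    where
    dom<n : All (_< n) (dom E)
    dom<n = all-dom E (++⁻ʳ (bnStack π) (++⁻ʳ (bnDump D) b))
  ... | naming c e d a _ _ = c , trans e (ren-id (λ _ → refl) ⌊ u ⌋) ,
    Unique-resp-↭
      (solve 4 (λ D c π E → ((D ⊕ π ⊕ E) ⊕ c) ⊜ (D ⊕ c ⊕ π ⊕ E))
        ↭-refl (bnDump D) (bnCode c) (bnStack π) (bnEnv E))
      (unique-++⁺ w d (separated b a))

  stuck-absurd : ∀ {D t π E k u} → stat (envStat E) (decodeDump D (decodeStack π ⌊ t ⌋)) ≢ none →
                 ¬ (decode (st D t π E) ⊸[ k ] u)
  stuck-absurd {D} {t} {π} {E} f s =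
    f (trans (sym (stat-env E (decodeDump D (decodeStack π ⌊ t ⌋)))) (Step-reducible tt (⊸⇒Step s)))

  stack-absurd : ∀ {t π E k u} → StackOk E π → stat (envStat E) ⌊ t ⌋ ≡ inert →
                 ¬ (decode (st ε t π E) ⊸[ k ] u)
  stack-absurd {t} {π} {E} p q = stuck-absurd {ε} {t} {π} {E} (λ z → inert≢none (trans (sym (stack-inert π p q)) z))

  progress : ∀ {k t} s → Invariant s → decode s ⊸[ k ] t → ∃[ l ] ∃[ s' ] (s ⇝[ l ] s')
  progress (st D (app t u) π E) i r = _ , _ , c₁
  progress (st D (ƛ x t) (φ ^ l ∷ π) E) i r = _ , _ , um
  progress (st (D ∶⟨ u , π ⟩) (ƛ x t) ε E) i r = _ , _ , c₂
  progress (st ε (ƛ x t) ε E) i r = ⊥-elim (stuck-absurd {ε} {ƛ x t} {ε} {E} val≢none r)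
  progress (st (D ∶⟨ u , π ⟩) (cst a) π' E) i r = _ , _ , c₃
  progress (st ε (cst a) π E) i r = ⊥-elim (stack-absurd {cst a} {π} {E} (Invariant.stackOk i) refl r)
  progress s@(st D (var x) π E) i r with lookup-split E x (Invariant.focusScoped i x refl)
  progress (st (D ∶⟨ t , π ⟩) (var x) π' E) i r | E₁ , φ , 𝖠 , E₂ , e = _ , _ , c₄ E₁ φ E₂ e
  progress s@(st ε (var x) π E) i r | E₁ , φ , 𝖠 , E₂ , refl =
    ⊥-elim (stack-absurd {var x} {π} {E} (Invariant.stackOk i)
      (lookup-status E₁ (Invariant.envOk i) (invariant-dom s i)) r)
  progress s@(st D (var x) π E) i r | E₁ , φ , 𝗏 , E₂ , refl with isCode (lookup-ok E₁ (Invariant.envOk i))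
  progress s@(st D (var x) π@(_ ^ _ ∷ _) E) i r | E₁ , φ , 𝗏 , E₂ , refl | u , refl
    with rename-fresh D u π E (λ y j → dom-suffix E₁ (scoped (lookup-ok E₁ (Invariant.envOk i)) y j))
                      (Invariant.wellNamed i)
  ... | uᵅ , α , w = _ , _ , ue E₁ u E₂ uᵅ refl α w
  progress (st (D ∶⟨ t , π ⟩) (var x) ε E) i r | E₁ , φ , 𝗏 , E₂ , refl | u , refl =
    _ , _ , c₅ E₁ u E₂ refl
  progress s@(st ε (var x) ε E) i r | E₁ , φ , 𝗏 , E₂ , refl | u , refl =
    ⊥-elim (stuck-absurd {ε} {var x} {ε} {E}
      (λ z → val≢none (trans (sym (lookup-status E₁ (Invariant.envOk i) (invariant-dom s i))) z)) r)

  initial-surjective : ∀ t → IsλTerm t → Closed t → ∃[ s ] (InitialState s × decode s ≡ t)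
  initial-surjective t p c with name (λ x → x) 0 p (λ x i → ⊥-elim (c x i))
  ... | naming k e d _ _ _ = st ε k ε [] , initial k (subst Closed (sym e') c) d , e'
    where
    e' = trans e (ren-id (λ _ → refl) t)

  open Distilleries GLAMoUr _⊸[_]_ _≋_ decode

  derivable-good : ∀ {t} → Derivable t → Good ∅ t
  derivable-good (_ , p , steps) = go (isλ-good p) steps
    where
    go : ∀ {t u} → Good ∅ t → Star (λ u w → (∃[ k ] u ⊸[ k ] w) ⊎ u ≋ w) t u → Good ∅ u
    go g ε                    = g
    go g (inj₁ (_ , s) ◅ ss) = go (good-Step tt (⊸⇒Step s) g) ss
    go g (inj₂ e ◅ ss)       = go (good-≋ e g) ss

  isReflectiveExplicitDistillery : IsReflectiveExplicitDistillery
  isReflectiveExplicitDistillery = record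
    { isDistillery = record
      { machine-deterministic = λ r → machine-deterministic (reachable-invariant r)
      ; initial-λTerm         = λ { (initial t c u) → isλ-⌊⌋ t , c }
      ; initial-injective     = λ { (initial t c u) (initial t' c' u') e → focusα e }
      ; initial-surjective    = initial-surjective
      ; strategy-deterministic = ⊸-deterministic
      ; ∼-isEquivalence       = record { refl = ≋-refl ; sym = ≋-sym ; trans = ≋-trans }
      ; ∼-strongBisimulation  = λ d → ≋-bisimulation (derivable-good d)
      ; principal-decodes     = λ r p t → _ , decode-principal (reachable-invariant r) p t
      ; commutative-decodes   = λ r p t → ≋-reflexive (decode-commutative p t)
      }
    ; isReflective = record
      { commutative-terminates = λ _ → commutative-terminates _
      ; progress               = λ r → progress _ (reachable-invariant r)
      }
    ; isExplicit = record
      { principal-preserves-kind = λ r → decode-principal (reachable-invariant r)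
      }
    }

  commutative-labels : ∀ {l} → l ∈ (c₁ ∷ c₂ ∷ c₃ ∷ c₄ ∷ c₅ ∷ []) → mrole l ≡ commutative
  commutative-labels = All.lookup {P = λ l → mrole l ≡ commutative} (refl ∷ refl ∷ refl ∷ refl ∷ refl ∷ [])

theorem9 : (Sym : Set) →
    let open Calculus Sym
        open Machine GLAMoUr
        open Distilleries GLAMoUr _⊸[_]_ _≋_ decode
    in
    IsReflectiveExplicitDistillery ×
    (∀ s → Reachable s →
      (∀ l s' → l ∈ (c₁ ∷ c₂ ∷ c₃ ∷ c₄ ∷ c₅ ∷ []) → s ⇝[ l ] s' → decode s ≡ decode s') ×
      (∀ s' → s ⇝[ um ] s' → ∃[ t ] (decode s ⊸[ multiplicative ] t × t ≋ decode s')) ×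
      (∀ s' → s ⇝[ ue ] s' → decode s ⊸[ exponential ] decode s'))
theorem9 Sym =
  isReflectiveExplicitDistillery ,
  λ s r →
    (λ l s' i → decode-commutative (commutative-labels i)) ,
    (λ s' → decode-um (reachable-invariant r)) ,
    (λ s' → decode-ue (reachable-invariant r))
  where
  open Proof Sym
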